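{- Let $r\ge 2$ be an integer and let $T$ be a tight $r$-tree with $t\le 4$ edges. If $G$ is an $r$-graph that does not contain $T$, then $$e(G)\le\frac{t-1}{r}|\partial(G)|.$$
   Context: An $r$-graph is a (finite) $r$-uniform hypergraph; $e(G)$ is the number of edges of $G$. The shadow of an $r$-graph $G$ is $\partial(G)=\{S: |S|=r-1,\ S\subseteq e\text{ for some }e\in E(G)\}$. An $r$-graph $T$ is a tight $r$-tree if its edges can be ordered as $e_1,\dots,e_t$ ($t\ge 1$) so that for each $i\ge 2$ there are a vertex $v\in e_i$ and an index $1\le s\le i-1$ such that $v\notin\bigcup_{j=1}^{i-1}e_j$ and $e_i\setminus\{v\}\subset e_s$. The vertex set of a tight tree is the union of its edges. An $r$-graph $G$ contains $T$ if there is an injection $V(T)\to V(G)$ mapping every edge of $T$ to an edge of $G$. -}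

module Defs where

open import Data.Empty using (⊥)
open import Data.Fin using (Fin; toℕ)
open import Data.Fin.Properties using (any?; _≟_)
open import Data.Fin.Subset using (Subset; inside; outside; ∣_∣; _∈_; _∉_; _⊆_; _-_)
open import Data.Fin.Subset.Properties using (_∈?_; _⊆?_)
open import Data.List using (List; []; _∷_; _++_; map; filter; length; lookup)
open import Data.List.Membership.Propositional using () renaming (_∈_ to _∈ₗ_)
open import Data.List.Membership.Propositional.Properties
  using (∈-map⁺; ∈-map⁻; ∈-++⁺ˡ; ∈-++⁺ʳ)
open import Data.List.Relation.Binary.Permutation.Propositional using (_↭_)
open import Data.List.Relation.Unary.All as All using (All)
import Data.List.Relation.Unary.AllPairs as AllPairs
open import Data.List.Relation.Unary.Any as Any using (Any; here)
open import Data.List.Relation.Unary.Unique.Propositional using (Unique)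
open import Data.List.Relation.Unary.Unique.Propositional.Properties using (map⁺; ++⁺)
open import Data.Nat using (ℕ; zero; suc; _∸_; _≤_; _<_)
import Data.Nat.Properties as ℕ
open import Data.Product using (Σ-syntax; ∃-syntax; _×_; _,_)
open import Data.Vec using ([]; _∷_; tabulate)
open import Data.Vec.Properties using ([]=⇒lookup; lookup⇒[]=; lookup∘tabulate; ∷-injectiveʳ)
open import Function using (_⇔_; mk⇔)
open import Function.Definitions using (Injective)
open import Relation.Binary.PropositionalEquality using (_≡_; refl; sym; trans)
open import Relation.Nullary using (Dec; yes; does)
open import Relation.Nullary.Decidable using (_×-dec_; dec-true)

private
  variable
    m n r : ℕ

record RGraph (n r : ℕ) : Set where
  field
    edges   : List (Subset n)
    unique  : Unique edges
    uniform : All (λ e → ∣ e ∣ ≡ r) edges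

open RGraph public

e[_] : RGraph n r → ℕ
e[ G ] = length (edges G)

subsets : (n : ℕ) → List (Subset n)
subsets zero    = [] ∷ []
subsets (suc n) = map (outside ∷_) (subsets n) ++ map (inside ∷_) (subsets n)

subsets-complete : (p : Subset n) → p ∈ₗ subsets n
subsets-complete []            = here refl
subsets-complete (outside ∷ p) = ∈-++⁺ˡ (∈-map⁺ (outside ∷_) (subsets-complete p))
subsets-complete (inside ∷ p)  =
  ∈-++⁺ʳ (map (outside ∷_) (subsets _)) (∈-map⁺ (inside ∷_) (subsets-complete p))

subsets-unique : (n : ℕ) → Unique (subsets n)
subsets-unique zero    = All.[] AllPairs.∷ AllPairs.[]
subsets-unique (suc n) =
  ++⁺ (map⁺ ∷-injectiveʳ (subsets-unique n)) (map⁺ ∷-injectiveʳ (subsets-unique n)) disjoint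
  where
  disjoint : ∀ {p} → p ∈ₗ map (outside ∷_) (subsets n) × p ∈ₗ map (inside ∷_) (subsets n) →
             ⊥
  disjoint (p∈ , q∈) with ∈-map⁻ (outside ∷_) p∈ | ∈-map⁻ (inside ∷_) q∈
  ... | _ , _ , refl | _ , _ , ()

InShadow : RGraph n r → Subset n → Set
InShadow {r = r} G S = ∣ S ∣ ≡ r ∸ 1 × Any (λ e → S ⊆ e) (edges G)

inShadow? : (G : RGraph n r) (S : Subset n) → Dec (InShadow G S)
inShadow? {r = r} G S = (∣ S ∣ ℕ.≟ r ∸ 1) ×-dec Any.any? (S ⊆?_) (edges G)

∂ : RGraph n r → List (Subset n)
∂ {n} G = filter (inShadow? G) (subsets n)

TightOrder : List (Subset n) → Set
TightOrder {n} es = (i : Fin (length es)) → 1 ≤ toℕ i →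
  Σ[ v ∈ Fin n ] Σ[ s ∈ Fin (length es) ]
    v ∈ lookup es i
  × (∀ j → toℕ j < toℕ i → v ∉ lookup es j)
  × toℕ s < toℕ i
  × (lookup es i - v) ⊆ lookup es s

record IsTightTree (T : RGraph n r) : Set where
  field
    nonEmpty : 1 ≤ e[ T ]
    ordering : List (Subset n)
    permutes : ordering ↭ edges T
    tight    : TightOrder ordering
    -- The vertex set of a tight tree is the union of its edges: no isolated vertices.
    covered  : (v : Fin n) → Any (λ e → v ∈ e) (edges T)

image : (Fin m → Fin n) → Subset m → Subset n
image f p = tabulate λ y → does (any? λ x → (x ∈? p) ×-dec (f x ≟ y))

∈-image : (f : Fin m → Fin n) (p : Subset m) (y : Fin n) →
          y ∈ image f p ⇔ (∃[ x ] x ∈ p × f x ≡ y)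
∈-image {m} f p y = mk⇔
  (λ y∈ → witness (preimage? y) (trans (sym eq) ([]=⇒lookup y∈)))
  (λ x → lookup⇒[]= y (image f p) (trans eq (dec-true (preimage? y) x)))
  where
  witness : {A : Set} (a? : Dec A) → does a? ≡ inside → A
  witness (yes a) _ = a
  preimage? : (z : Fin _) → Dec (∃[ x ] x ∈ p × f x ≡ z)
  preimage? z = any? λ x → (x ∈? p) ×-dec (f x ≟ z)
  eq = lookup∘tabulate (λ z → does (preimage? z)) y

Contains : RGraph n r → RGraph m r → Set
Contains {n} {m = m} G T = Σ[ f ∈ (Fin m → Fin n) ]
  Injective _≡_ _≡_ f × All (λ e → image f e ∈ₗ edges G) (edges T)

{-# OPTIONS --safe #-}

-- Since the degrees of the (r−1)-sets sum to r e(G), the claim is that the positive degrees are at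
-- most t−1 on average. A tight tree with at most 4 edges is a cone over a fixed vertex set K of one of
-- nine small trees: 1 to 4 single vertices, the 3-edge path, the fork or the 4-edge path (graphs), the
-- triple star or the tight path (3-graphs). So G contains the tree as soon as the link of some set of
-- size |K| contains the small one, and averaging over links reduces the claim to the small trees.
-- There a facet of degree > t−1 is compensated by nearby facets of degree < t−1. For 3-graphs one may
-- first delete edges as long as at least as many pairs leave the shadow; this disposes of pairs of
-- degree 1 and, for the tight path, of triples xuy, xuv, xyv in which xu, xy and xv have degree 2.
module Submission where

open import Defs
open import Algebra.Properties.CommutativeSemigroup using (interchange; x∙yz≈y∙xz)
open import Data.Bool.Properties using () renaming (_≟_ to _≟ᵇ_)
open import Data.Empty using (⊥; ⊥-elim)
open import Data.Fin using (Fin; zero; suc; toℕ)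
import Data.Fin.Properties as Fin
open import Data.Fin.Subset using (Subset; inside; outside; ∣_∣; _-_)
  renaming (_∈_ to _∈ₛ_; _∉_ to _∉ₛ_; _⊆_ to _⊆ₛ_)
open import Data.Fin.Subset.Properties
  using (⊆-antisym; p⊆q⇒∣p∣≤∣q∣; p⊂q⇒∣p∣<∣q∣; x∈p∧x≢y⇒x∈p-y) renaming (_∈?_ to _∈ₛ?_)
import Data.Integer as ℤ
import Data.Integer.Properties as ℤ
open import Data.List
  using (List; []; _∷_; _++_; map; filter; length; lookup; allFin; cartesianProduct; take; zip)
import Data.List.Membership.DecPropositional as DecMembership
open import Data.List.Membership.Propositional using (_∈_; _∉_; find; lose)
open import Data.List.Membership.Propositional.Properties
  using ( ∈-++⁻; ∈-++⁺ˡ; ∈-++⁺ʳ; ∈-∃++; ∈-allFin; ∈-cartesianProduct⁺; ∈-filter⁺; ∈-filter⁻; ∈-lookup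
        ; ∈-map⁺; ∈-map⁻)
open import Data.List.Properties using (length-++; length-take; map-tabulate; map-∘)
open import Data.List.Relation.Binary.Permutation.Propositional as ↭ using (_↭_)
open import Data.List.Relation.Binary.Permutation.Propositional.Properties using (All-resp-↭; ↭-length)
open import Data.List.Relation.Unary.All as All using (All; []; _∷_)
open import Data.List.Relation.Unary.All.Properties using (¬Any⇒All¬; all-filter)
  renaming (++⁺ to All-++⁺; map⁺ to All-map⁺; map⁻ to All-map⁻; take⁺ to All-take⁺)
open import Data.List.Relation.Unary.AllPairs using ([]; _∷_)
open import Data.List.Relation.Unary.Any as Any using (Any; here; there)
open import Data.List.Relation.Unary.Unique.Propositional using (Unique)
open import Data.List.Relation.Unary.Unique.Propositional.Properties
  using (allFin⁺; cartesianProduct⁺; filter⁺; take⁺)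
open import Data.Nat
  using (ℕ; zero; suc; _+_; _*_; _∸_; _≤_; _<_; z≤n; s≤s; _<?_; _≤?_; pred; NonZero; >-nonZero)
open import Data.Nat.Induction using (<-wellFounded)
open import Data.Nat.Properties
open import Data.Product using (∃-syntax; _×_; _,_; proj₁; proj₂; map₂)
open import Data.Product.Properties using (≡-dec)
import Data.Rational as ℚ
import Data.Rational.Properties as ℚ
import Data.Rational.Unnormalised as ℚᵘ
import Data.Rational.Unnormalised.Properties as ℚᵘ
open import Data.Sum using (_⊎_; inj₁; inj₂; [_,_]′)
open import Data.Unit using (⊤; tt)
open import Data.Vec using ([]; _∷_; _[_]≔_)
import Data.Vec as Vec
open import Data.Vec.Properties
  using ( []≔-commutes; []≔-updates; []≔-minimal; []≔-idempotent; []≔-lookup; lookup∘update′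
        ; []=⇒lookup; lookup⇒[]=; []=-injective)
  renaming (≡-dec to ≡-decᵥ)
open import Function using (_∘_; id)
open import Function.Bundles using (Equivalence)
open import Induction.WellFounded using (Acc; acc)
open import Relation.Binary using (DecidableEquality; tri<; tri≈; tri>)
open import Relation.Binary.PropositionalEquality
open import Relation.Nullary using (Dec; yes; no; ¬_; contradiction)
open import Relation.Nullary.Decidable using (_×-dec_; ¬?; decidable-stable)
open import Relation.Unary using (Decidable)

-- Beyond single vertices the small trees are treated by discharging with target degree t - 1: high
-- facets draw on low facets in common edges. In a graph even a neighbour of degree 1 is a good
-- donor. In a 3-graph a facet of degree 1 lies in no second edge and so blocks the greedy
-- embedding. Deleting one edge together with one lost pair is harmless there, because for r = 3 and
-- t = 4 the claim reads e(G) ≤ |∂(G)|, and freeness survives deletion. Averaging over links loses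
-- nothing: on both sides of the inequality a facet is counted once for each way of building it up
-- from the vertex set of the link, and this number depends on its size only, so it cancels. For the
-- classification, equality of sizes makes each new edge an earlier edge with one old vertex
-- exchanged for a new one. The exchanges form a tree on at most four edges, hence a star or a path.
-- They are reversible, so any edge may serve as the centre. The nine cases come from coincidences
-- among the removed vertices, and K is what remains of one edge without them.

private
  variable
    m n r : ℕ
    A B   : Set
    P Q R : Set

-- Finite sums and counting

∑ : List A → (A → ℕ) → ℕ
∑ []       f = 0
∑ (x ∷ xs) f = f x + ∑ xs f

infixr 8 ∑
syntax ∑ xs (λ x → e) = ∑[ x ∈ xs ] e

∑-mono-∈ : (xs : List A) {f g : A → ℕ} → (∀ {x} → x ∈ xs → f x ≤ g x) → ∑ xs f ≤ ∑ xs g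
∑-mono-∈ []       f≤g = z≤n
∑-mono-∈ (x ∷ xs) f≤g = +-mono-≤ (f≤g (here refl)) (∑-mono-∈ xs (f≤g ∘ there))

∑-mono : (xs : List A) {f g : A → ℕ} → (∀ x → f x ≤ g x) → ∑ xs f ≤ ∑ xs g
∑-mono xs f≤g = ∑-mono-∈ xs (λ {x} _ → f≤g x)

∑-cong : (xs : List A) {f g : A → ℕ} → (∀ x → f x ≡ g x) → ∑ xs f ≡ ∑ xs g
∑-cong []       f≡g = refl
∑-cong (x ∷ xs) f≡g = cong₂ _+_ (f≡g x) (∑-cong xs f≡g)

∑-+ : (xs : List A) (f g : A → ℕ) → ∑[ x ∈ xs ] (f x + g x) ≡ ∑ xs f + ∑ xs g
∑-+ []       f g = refl
∑-+ (x ∷ xs) f g =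
  trans (cong (f x + g x +_) (∑-+ xs f g)) (interchange +-commutativeSemigroup (f x) (g x) (∑ xs f) (∑ xs g))

∑-* : (xs : List A) (c : ℕ) (f : A → ℕ) → ∑[ x ∈ xs ] (c * f x) ≡ c * ∑ xs f
∑-* []       c f = sym (*-zeroʳ c)
∑-* (x ∷ xs) c f = trans (cong (c * f x +_) (∑-* xs c f)) (sym (*-distribˡ-+ c (f x) (∑ xs f)))

∑-zero : (xs : List A) → ∑[ _ ∈ xs ] 0 ≡ 0
∑-zero []       = refl
∑-zero (x ∷ xs) = ∑-zero xs

∑-comm : (xs : List A) (ys : List B) (f : A → B → ℕ) →
         ∑[ x ∈ xs ] ∑[ y ∈ ys ] f x y ≡ ∑[ y ∈ ys ] ∑[ x ∈ xs ] f x y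
∑-comm []       ys f = sym (∑-zero ys)
∑-comm (x ∷ xs) ys f = trans (cong (∑ ys (f x) +_) (∑-comm xs ys f)) (sym (∑-+ ys (f x) _))

∑-++ : (xs ys : List A) (f : A → ℕ) → ∑ (xs ++ ys) f ≡ ∑ xs f + ∑ ys f
∑-++ []       ys f = refl
∑-++ (x ∷ xs) ys f = trans (cong (f x +_) (∑-++ xs ys f)) (sym (+-assoc (f x) (∑ xs f) (∑ ys f)))

∑-map : (g : A → B) (xs : List A) (f : B → ℕ) → ∑ (map g xs) f ≡ ∑ xs (f ∘ g)
∑-map g []       f = refl
∑-map g (x ∷ xs) f = cong (f (g x) +_) (∑-map g xs f)

∑-× : (xs : List A) (ys : List B) (f : A × B → ℕ) →
      ∑ (cartesianProduct xs ys) f ≡ ∑[ x ∈ xs ] ∑[ y ∈ ys ] f (x , y)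
∑-× []       ys f = refl
∑-× (x ∷ xs) ys f = trans (∑-++ (map (x ,_) ys) (cartesianProduct xs ys) f)
  (cong₂ _+_ (∑-map (x ,_) ys f) (∑-× xs ys f))

⟦_⟧ : Dec P → ℕ
⟦ yes _ ⟧ = 1
⟦ no  _ ⟧ = 0

⟦⟧-mono : (P → Q) → (p : Dec P) (q : Dec Q) → ⟦ p ⟧ ≤ ⟦ q ⟧
⟦⟧-mono P⇒Q (yes p) (yes q) = ≤-refl
⟦⟧-mono P⇒Q (yes p) (no ¬q) = contradiction (P⇒Q p) ¬q
⟦⟧-mono P⇒Q (no ¬p) q       = z≤n

⟦⟧-cong : (P → Q) → (Q → P) → (p : Dec P) (q : Dec Q) → ⟦ p ⟧ ≡ ⟦ q ⟧
⟦⟧-cong P⇒Q Q⇒P p q = ≤-antisym (⟦⟧-mono P⇒Q p q) (⟦⟧-mono Q⇒P q p)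

⟦⟧-yes : (p : Dec P) → P → ⟦ p ⟧ ≡ 1
⟦⟧-yes (yes _) _ = refl
⟦⟧-yes (no ¬p) p = contradiction p ¬p

⟦⟧-no : (p : Dec P) → ¬ P → ⟦ p ⟧ ≡ 0
⟦⟧-no (yes p) ¬p = contradiction p ¬p
⟦⟧-no (no _)  _  = refl

⟦⟧-⊎ : (P → Q ⊎ R) → (p : Dec P) (q : Dec Q) (r : Dec R) → ⟦ p ⟧ ≤ ⟦ q ⟧ + ⟦ r ⟧
⟦⟧-⊎ P⇒Q⊎R (no _)  q       r       = z≤n
⟦⟧-⊎ P⇒Q⊎R (yes _) (yes _) r       = s≤s z≤n
⟦⟧-⊎ P⇒Q⊎R (yes _) (no _)  (yes _) = s≤s z≤n
⟦⟧-⊎ P⇒Q⊎R (yes p) (no ¬q) (no ¬r) with P⇒Q⊎R p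
... | inj₁ q = contradiction q ¬q
... | inj₂ r = contradiction r ¬r

⟦⟧-disjoint : (Q → P) → (R → P) → (Q → ¬ R) → (q : Dec Q) (r : Dec R) (p : Dec P) →
              ⟦ q ⟧ + ⟦ r ⟧ ≤ ⟦ p ⟧
⟦⟧-disjoint Q⇒P R⇒P Q⇒¬R (yes q) (yes r) p = contradiction r (Q⇒¬R q)
⟦⟧-disjoint Q⇒P R⇒P Q⇒¬R (yes q) (no _)  p = ⟦⟧-mono Q⇒P (yes q) p
⟦⟧-disjoint Q⇒P R⇒P Q⇒¬R (no _)  r       p = ⟦⟧-mono R⇒P r p

-- Summing `pos` over degrees counts the facets of positive degree, that is, the shadow.
pos : ℕ → ℕ
pos zero    = 0
pos (suc _) = 1

pos-mono : ∀ {a b} → a ≤ b → pos a ≤ pos b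
pos-mono z≤n     = z≤n
pos-mono (s≤s _) = ≤-refl

0<⇒pos≡1 : ∀ {a} → 0 < a → pos a ≡ 1
0<⇒pos≡1 (s≤s _) = refl

unique-⊆⇒length≤ : {xs ys : List A} → Unique xs → (∀ {x} → x ∈ xs → x ∈ ys) → length xs ≤ length ys
unique-⊆⇒length≤ {xs = []}     []        ⊆ys = z≤n
unique-⊆⇒length≤ {xs = x ∷ xs} (x∉ ∷ un) ⊆ys with ∈-∃++ (⊆ys (here refl))
... | as , bs , refl = begin
  suc (length xs)             ≤⟨ s≤s (unique-⊆⇒length≤ un ⊆as++bs) ⟩
  suc (length (as ++ bs))     ≡⟨ cong suc (length-++ as) ⟩
  suc (length as + length bs) ≡⟨ +-suc (length as) (length bs) ⟨
  length as + suc (length bs) ≡⟨ length-++ as ⟨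
  length (as ++ x ∷ bs)       ∎
  where
  open ≤-Reasoning
  ⊆as++bs : ∀ {z} → z ∈ xs → z ∈ as ++ bs
  ⊆as++bs z∈ with ∈-++⁻ as (⊆ys (there z∈))
  ... | inj₁ z∈as         = ∈-++⁺ˡ z∈as
  ... | inj₂ (here refl)  = contradiction refl (All.lookup x∉ z∈)
  ... | inj₂ (there z∈bs) = ∈-++⁺ʳ as z∈bs

module _ {P : A → Set} (P? : Decidable P) where

  # : List A → ℕ
  # xs = ∑[ x ∈ xs ] ⟦ P? x ⟧

  #≡length-filter : (xs : List A) → # xs ≡ length (filter P? xs)
  #≡length-filter []       = refl
  #≡length-filter (x ∷ xs) with P? x
  ... | yes _ = cong suc (#≡length-filter xs)
  ... | no  _ = #≡length-filter xs

  #-≤ : {xs : List A} → Unique xs → (ys : List A) → (∀ x → P x → x ∈ ys) → # xs ≤ length ys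
  #-≤ {xs} un ys P⇒∈ = subst (_≤ length ys) (sym (#≡length-filter xs))
    (unique-⊆⇒length≤ (filter⁺ P? un) (λ {x} x∈ → P⇒∈ x (proj₂ (∈-filter⁻ P? {xs = xs} x∈))))

  #-≥ : {xs ys : List A} → Unique ys → (∀ x → x ∈ xs) → All P ys → length ys ≤ # xs
  #-≥ {xs} {ys} un all∈ Pys = subst (length ys ≤_) (sym (#≡length-filter xs))
    (unique-⊆⇒length≤ un (λ {y} y∈ → ∈-filter⁺ P? (all∈ y) (All.lookup Pys y∈)))

  pick : DecidableEquality A → {xs : List A} → Unique xs → (ys : List A) → length ys < # xs →
         ∃[ x ] P x × All (x ≢_) ys
  pick _≟_ {xs} un ys ys<# with Any.any? (λ x → ¬? (x ∈? ys)) (filter P? xs)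
    where open DecMembership _≟_ using (_∈?_)
  ... | yes any = let x , x∈ , x∉ys = find any in
                  x , proj₂ (∈-filter⁻ P? {xs = xs} x∈) , ¬Any⇒All¬ ys x∉ys
  ... | no ¬any = contradiction
    (subst (_≤ length ys) (sym (#≡length-filter xs)) (unique-⊆⇒length≤ (filter⁺ P? un) ∈ys))
    (<⇒≱ ys<#)
    where
    open DecMembership _≟_ using (_∈?_)
    ∈ys : ∀ {x} → x ∈ filter P? xs → x ∈ ys
    ∈ys {x} x∈ = decidable-stable (x ∈? ys) (λ x∉ys → ¬any (lose x∈ x∉ys))

#-mono : {P Q : A → Set} (P? : Decidable P) (Q? : Decidable Q) (xs : List A) →
         (∀ x → P x → Q x) → # P? xs ≤ # Q? xs
#-mono P? Q? xs P⇒Q = ∑-mono xs (λ x → ⟦⟧-mono (P⇒Q x) (P? x) (Q? x))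

-- h x y is the charge that x receives from y.
discharging : (xs : List A) (f g : A → ℕ) (h : A → A → ℕ) →
              (∀ x → f x + ∑[ y ∈ xs ] h y x ≤ g x + ∑[ y ∈ xs ] h x y) → ∑ xs f ≤ ∑ xs g
discharging xs f g h local = +-cancelʳ-≤ (∑[ x ∈ xs ] ∑[ y ∈ xs ] h x y) (∑ xs f) (∑ xs g) (begin
  ∑ xs f + (∑[ x ∈ xs ] ∑[ y ∈ xs ] h x y)   ≡⟨ cong (∑ xs f +_) (∑-comm xs xs h) ⟩
  ∑ xs f + (∑[ x ∈ xs ] ∑[ y ∈ xs ] h y x)   ≡⟨ ∑-+ xs f _ ⟨
  ∑[ x ∈ xs ] (f x + ∑[ y ∈ xs ] h y x)      ≤⟨ ∑-mono xs local ⟩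
  ∑[ x ∈ xs ] (g x + ∑[ y ∈ xs ] h x y)      ≡⟨ ∑-+ xs g _ ⟩
  ∑ xs g + (∑[ x ∈ xs ] ∑[ y ∈ xs ] h x y)   ∎)
  where open ≤-Reasoning

#-none : {P : A → Set} (P? : Decidable P) (xs : List A) → (∀ x → ¬ P x) → # P? xs ≡ 0
#-none P? xs ¬P = trans (∑-cong xs (λ x → ⟦⟧-no (P? x) (¬P x))) (∑-zero xs)

infix 4 _∉ₚ_

-- A tuple instead of All, so that it can be matched irrefutably in a let.
_∉ₚ_ : A → List A → Set
x ∉ₚ []       = ⊤
x ∉ₚ (y ∷ ys) = x ≢ y × x ∉ₚ ys

-- The greedy step of every embedding below: more candidates than forbidden vertices leave a free
-- one. Distinctness from the vertices of the facet whose degree is used comes from irreflexivity,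
-- so `ys` lists only the other vertices already placed.
pickFin : ∀ {n} {P : Fin n → Set} (P? : Decidable P) (ys : List (Fin n)) →
          length ys < # P? (allFin n) → ∃[ x ] P x × x ∉ₚ ys
pickFin {n} P? ys ys<# with pick P? Fin._≟_ (allFin⁺ n) ys ys<#
... | x , Px , x≢ys = x , Px , avoids x≢ys
  where
  avoids : ∀ {x} {zs : List (Fin n)} → All (x ≢_) zs → x ∉ₚ zs
  avoids []           = tt
  avoids (x≢z ∷ x≢zs) = x≢z , avoids x≢zs

-- Graphs

module Graph {n : ℕ} {E : Fin n → Fin n → Set} (E? : ∀ x y → Dec (E x y))
             (E-sym : ∀ {x y} → E x y → E y x) (E-irrefl : ∀ {x y} → E x y → x ≢ y) where

  V : List (Fin n)
  V = allFin n

  d : Fin n → ℕ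
  d x = # (E? x) V

  -- Each vertex of degree below `k` gives 1 to each neighbour of degree above `k`. By `high` a
  -- vertex above `k` has at most `k` neighbours that do not pay, so it is brought down to `k`; by
  -- `low` a payer does not rise above `k`.
  degree-bound : (k : ℕ) →
    (∀ x → k < d x → # (λ y → E? x y ×-dec (k ≤? d y)) V ≤ k) →
    (∀ x → 0 < d x → d x < k → d x + # (λ y → E? x y ×-dec (k <? d y)) V ≤ k) →
    ∑ V d ≤ k * ∑ V (pos ∘ d)
  degree-bound k high low = ≤-trans
    (discharging V d (λ x → k * pos (d x)) (λ x y → ⟦ h? x y ⟧) local)
    (≤-reflexive (∑-* V k (pos ∘ d)))
    where
    open ≤-Reasoning
    h? : ∀ x y → Dec (E x y × k < d x × d y < k)
    h? x y = E? x y ×-dec (k <? d x) ×-dec (d y <? k)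
    k-pos : ∀ x → 0 < d x → k * pos (d x) ≡ k
    k-pos x 0<d = trans (cong (k *_) (0<⇒pos≡1 0<d)) (*-identityʳ k)
    local : ∀ x → d x + ∑[ y ∈ V ] ⟦ h? y x ⟧ ≤ k * pos (d x) + ∑[ y ∈ V ] ⟦ h? x y ⟧
    local x with 0 <? d x | <-cmp k (d x)
    ... | no 0≮d | _ = begin
      d x + # (λ y → h? y x) V ≤⟨ +-monoʳ-≤ (d x) (#-mono (λ y → h? y x) (E? x) V (λ _ → E-sym ∘ proj₁)) ⟩
      d x + d x                ≡⟨ cong₂ _+_ d≡0 d≡0 ⟩
      0                        ≤⟨ z≤n ⟩
      k * pos (d x) + # (h? x) V ∎
      where
      d≡0 : d x ≡ 0
      d≡0 = n≤0⇒n≡0 (≮⇒≥ 0≮d)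
    ... | yes 0<d | tri< k<d _ _ = begin
      d x + # (λ y → h? y x) V
        ≡⟨ cong (d x +_) (#-none (λ y → h? y x) V (λ _ (_ , _ , d<k) → <-asym d<k k<d)) ⟩
      d x + 0
        ≡⟨ +-identityʳ (d x) ⟩
      d x
        ≤⟨ ∑-mono V (λ y → ⟦⟧-⊎ (split y) (E? x y) (E? x y ×-dec (k ≤? d y)) (h? x y)) ⟩
      ∑[ y ∈ V ] (⟦ E? x y ×-dec (k ≤? d y) ⟧ + ⟦ h? x y ⟧)
        ≡⟨ ∑-+ V _ _ ⟩
      # (λ y → E? x y ×-dec (k ≤? d y)) V + # (h? x) V
        ≤⟨ +-monoˡ-≤ _ (high x k<d) ⟩
      k + # (h? x) V
        ≡⟨ cong (_+ # (h? x) V) (k-pos x 0<d) ⟨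
      k * pos (d x) + # (h? x) V ∎
      where
      split : ∀ y → E x y → (E x y × k ≤ d y) ⊎ (E x y × k < d x × d y < k)
      split y e with k ≤? d y
      ... | yes k≤d = inj₁ (e , k≤d)
      ... | no  k≰d = inj₂ (e , k<d , ≰⇒> k≰d)
    ... | yes 0<d | tri≈ _ k≡d _ = begin
      d x + # (λ y → h? y x) V
        ≡⟨ cong (d x +_) (#-none (λ y → h? y x) V (λ _ (_ , _ , d<k) → <-irrefl (sym k≡d) d<k)) ⟩
      d x + 0
        ≡⟨ +-identityʳ (d x) ⟩
      d x
        ≡⟨ k≡d ⟨
      k
        ≡⟨ k-pos x 0<d ⟨
      k * pos (d x)
        ≤⟨ m≤m+n _ _ ⟩
      k * pos (d x) + # (h? x) V ∎
    ... | yes 0<d | tri> _ _ d<k = begin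
      d x + # (λ y → h? y x) V
        ≤⟨ +-monoʳ-≤ (d x) (#-mono (λ y → h? y x) _ V (λ _ (e , k<d , _) → E-sym e , k<d)) ⟩
      d x + # (λ y → E? x y ×-dec (k <? d y)) V
        ≤⟨ low x 0<d d<k ⟩
      k
        ≡⟨ k-pos x 0<d ⟨
      k * pos (d x)
        ≤⟨ m≤m+n _ _ ⟩
      k * pos (d x) + # (h? x) V ∎

  -- All neighbours of a high vertex are leaves, so all of them pay. A leaf pays at most once and
  -- ends at no more than 2 ≤ k; a vertex of degree at least 2 has no high neighbour and pays
  -- nothing.
  leaf-bound : (k : ℕ) → 2 ≤ k → (∀ {x y} → E x y → k < d x → d y ≤ 1) →
               ∑ V d ≤ k * ∑ V (pos ∘ d)
  leaf-bound k 2≤k leaf = degree-bound k high low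
    where
    open ≤-Reasoning
    high : ∀ x → k < d x → # (λ y → E? x y ×-dec (k ≤? d y)) V ≤ k
    high x k<d = subst (_≤ k)
      (sym (#-none _ V (λ y (e , k≤d) → <⇒≱ (s≤s (leaf e k<d)) (≤-trans 2≤k k≤d)))) z≤n
    low : ∀ x → 0 < d x → d x < k → d x + # (λ y → E? x y ×-dec (k <? d y)) V ≤ k
    low x 0<d d<k with d x ≤? 1
    ... | yes d≤1 = begin
      d x + # (λ y → E? x y ×-dec (k <? d y)) V ≤⟨ +-monoʳ-≤ (d x) (#-mono _ (E? x) V (λ _ → proj₁)) ⟩
      d x + d x                                 ≤⟨ +-mono-≤ d≤1 d≤1 ⟩
      2                                         ≤⟨ 2≤k ⟩
      k                                         ∎
    ... | no d≰1 = begin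
      d x + # (λ y → E? x y ×-dec (k <? d y)) V
        ≡⟨ cong (d x +_) (#-none _ V (λ y (e , k<d) → d≰1 (leaf (E-sym e) k<d))) ⟩
      d x + 0                                   ≡⟨ +-identityʳ (d x) ⟩
      d x                                       ≤⟨ <⇒≤ d<k ⟩
      k                                         ∎

  -- If a neighbour b of a vertex a of degree at least 3 had a further neighbour p, then a would
  -- have a neighbour q outside {b, p}, which completes the path.
  path₃-free : (∀ {p b a q} → Unique (p ∷ b ∷ a ∷ q ∷ []) → E p b → E b a → E a q → ⊥) →
               ∑ V d ≤ 2 * ∑ V (pos ∘ d)
  path₃-free free = leaf-bound 2 ≤-refl leaf
    where
    leaf : ∀ {a b} → E a b → 2 < d a → d b ≤ 1
    leaf {a} {b} ab 2<d = ≮⇒≥ λ 1<d →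
      let p , bp , p≢a , _ = pickFin (E? b) (a ∷ []) 1<d
          q , aq , q≢b , q≢p , _ = pickFin (E? a) (b ∷ p ∷ []) 2<d
      in free
        ( (E-irrefl (E-sym bp) ∷ p≢a ∷ ≢-sym q≢p ∷ []) ∷ (E-irrefl (E-sym ab) ∷ ≢-sym q≢b ∷ [])
        ∷ (E-irrefl aq ∷ []) ∷ [] ∷ [])
        (E-sym bp) (E-sym ab) aq

  -- As for the path, but degree at least 4 leaves a two free neighbours besides b and p.
  fork-free : (∀ {p b a q w} → Unique (p ∷ b ∷ a ∷ q ∷ w ∷ []) → E p b → E b a → E a q → E a w → ⊥) →
              ∑ V d ≤ 3 * ∑ V (pos ∘ d)
  fork-free free = leaf-bound 3 (s≤s (s≤s z≤n)) leaf
    where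
    leaf : ∀ {a b} → E a b → 3 < d a → d b ≤ 1
    leaf {a} {b} ab 3<d = ≮⇒≥ λ 1<d →
      let p , bp , p≢a , _ = pickFin (E? b) (a ∷ []) 1<d
          q , aq , q≢b , q≢p , _ = pickFin (E? a) (b ∷ p ∷ []) (<⇒≤ 3<d)
          w , aw , w≢b , w≢p , w≢q , _ = pickFin (E? a) (b ∷ p ∷ q ∷ []) 3<d
      in free
        ( (E-irrefl (E-sym bp) ∷ p≢a ∷ ≢-sym q≢p ∷ ≢-sym w≢p ∷ [])
        ∷ (E-irrefl (E-sym ab) ∷ ≢-sym q≢b ∷ ≢-sym w≢b ∷ [])
        ∷ (E-irrefl aq ∷ E-irrefl aw ∷ []) ∷ (≢-sym w≢q ∷ []) ∷ [] ∷ [])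
        (E-sym bp) (E-sym ab) aq aw

  -- Two neighbours of degree at least 3 of a high vertex already yield the path, which is more than
  -- `high` asks for. A vertex of degree at most 2 between two high neighbours would be the middle
  -- of the path, so it pays at most 1 and ends at no more than 3.
  path₄-free : (∀ {p u x v q} → Unique (p ∷ u ∷ x ∷ v ∷ q ∷ []) → E p u → E u x → E x v → E v q → ⊥) →
               ∑ V d ≤ 3 * ∑ V (pos ∘ d)
  path₄-free free = degree-bound 3 high low
    where
    path : ∀ {p u x v q} → E p u → E u x → E x v → E v q →
           p ≢ x → p ≢ v → p ≢ q → u ≢ v → u ≢ q → x ≢ q → ⊥
    path pu ux xv vq p≢x p≢v p≢q u≢v u≢q x≢q = free
      ( (E-irrefl pu ∷ p≢x ∷ p≢v ∷ p≢q ∷ []) ∷ (E-irrefl ux ∷ u≢v ∷ u≢q ∷ [])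
      ∷ (E-irrefl xv ∷ x≢q ∷ []) ∷ (E-irrefl vq ∷ []) ∷ [] ∷ [])
      pu ux xv vq

    high : ∀ x → 3 < d x → # (λ y → E? x y ×-dec (3 ≤? d y)) V ≤ 3
    high x 3<d = ≮⇒≥ λ 3<# →
      let v  , (xv , 3≤dv), _ = pickFin N? [] (≤-trans (s≤s z≤n) 3<#)
          v′ , (xv′ , 3≤dv′) , v′≢v , _ = pickFin N? (v ∷ []) (≤-trans (s≤s (s≤s z≤n)) 3<#)
          p , vp , p≢x , p≢v′ , _ = pickFin (E? v) (x ∷ v′ ∷ []) 3≤dv
          -- `z` is kept for the case that `v′` is adjacent to both `v` and `p`.
          z , xz , z≢v , z≢v′ , z≢p , _ = pickFin (E? x) (v ∷ v′ ∷ p ∷ []) 3<d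
          extend = λ q v′q (q≢x : q ≢ x) (q≢v : q ≢ v) (q≢p : q ≢ p) →
            path (E-sym vp) (E-sym xv) xv′ v′q p≢x p≢v′ (≢-sym q≢p) (≢-sym v′≢v) (≢-sym q≢v) (≢-sym q≢x)
      in neighbours xv xv′ vp xz 3≤dv′ p≢x p≢v′ v′≢v z≢v z≢v′ z≢p extend
      where
      N? : ∀ y → Dec (E x y × 3 ≤ d y)
      N? y = E? x y ×-dec (3 ≤? d y)
      neighbours : ∀ {v v′ p z} → E x v → E x v′ → E v p → E x z → 2 < d v′ → p ≢ x → p ≢ v′ → v′ ≢ v →
                   z ≢ v → z ≢ v′ → z ≢ p → (∀ q → E v′ q → q ≢ x → q ≢ v → q ≢ p → ⊥) → ⊥
      neighbours {v} {v′} {p} xv xv′ vp xz 2<d p≢x p≢v′ v′≢v z≢v z≢v′ z≢p extend with E? v′ v | E? v′ p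
      -- Here `x`, `v`, `p` may be all the neighbours of `v′`, so the path `z x v v′ p` replaces
      -- `p v x v′ q`. If `v′` misses `v` or `p`, that vertex need not be avoided explicitly and
      -- degree 3 suffices to find `q`.
      ... | yes v′v | yes v′p =
        path (E-sym xz) xv (E-sym v′v) v′p z≢v z≢v′ z≢p (E-irrefl xv′) (≢-sym p≢x) (E-irrefl vp)
      ... | no ¬v′v | _ =
        let q , v′q , q≢x , q≢p , _ = pickFin (E? v′) (x ∷ p ∷ []) 2<d
        in extend q v′q q≢x (λ { refl → ¬v′v v′q }) q≢p
      ... | yes _ | no ¬v′p =
        let q , v′q , q≢x , q≢v , _ = pickFin (E? v′) (x ∷ v ∷ []) 2<d
        in extend q v′q q≢x q≢v (λ { refl → ¬v′p v′q })

    low : ∀ x → 0 < d x → d x < 3 → d x + # (λ y → E? x y ×-dec (3 <? d y)) V ≤ 3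
    low y _ d<3 = +-mono-≤ (≤-pred d<3) (≮⇒≥ λ 1<# →
      let x  , (yx , 3<d), _ = pickFin N? [] (<⇒≤ 1<#)
          x′ , (yx′ , 3<d′) , x′≢x , _ = pickFin N? (x ∷ []) 1<#
          q  , xq  , q≢y , q≢x′ , _ = pickFin (E? x) (y ∷ x′ ∷ []) (<⇒≤ 3<d)
          q′ , xq′ , q′≢y , q′≢x , q′≢q , _ = pickFin (E? x′) (y ∷ x ∷ q ∷ []) 3<d′
      in path (E-sym xq) (E-sym yx) yx′ xq′ q≢y q≢x′ (≢-sym q′≢q) (≢-sym x′≢x) (≢-sym q′≢x) (≢-sym q′≢y))
      where
      N? : ∀ x → Dec (E y x × 3 < d x)
      N? x = E? y x ×-dec (3 <? d x)

-- 3-graphs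

-- A symmetric relation on ordered triples, the form in which links and edge deletions arise. The
-- two adjacent transpositions generate all reorderings, so one inequality of coordinates yields the
-- other two.
record Graph₃ (n : ℕ) : Set₁ where
  field
    E      : Fin n → Fin n → Fin n → Set
    E?     : ∀ x y z → Dec (E x y z)
    swap₁₂ : ∀ {x y z} → E x y z → E y x z
    swap₂₃ : ∀ {x y z} → E x y z → E x z y
    x≢y    : ∀ {x y z} → E x y z → x ≢ y

  x≢z : ∀ {x y z} → E x y z → x ≢ z
  x≢z = x≢y ∘ swap₂₃

  y≢z : ∀ {x y z} → E x y z → y ≢ z
  y≢z = x≢z ∘ swap₁₂

  d : Fin n → Fin n → ℕ
  d x y = # (E? x y) (allFin n)

  size support : ℕ
  size    = ∑[ x ∈ allFin n ] ∑[ y ∈ allFin n ] d x y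
  support = ∑[ x ∈ allFin n ] ∑[ y ∈ allFin n ] pos (d x y)

  -- Edges and pairs are counted in all orders, hence the factor t − 1 = 3 instead of 3/r = 1.
  Bounded : Set
  Bounded = size ≤ 3 * support

  d-sym : ∀ x y → d x y ≡ d y x
  d-sym x y = ∑-cong (allFin n) (λ z → ⟦⟧-cong swap₁₂ swap₁₂ (E? x y z) (E? y x z))

  saturated : ∀ {x y zs} → Unique zs → All (E x y) zs → d x y ≤ length zs → ∀ {z} → E x y z → z ∈ zs
  saturated {x} {y} {zs} un Ezs d≤ {z} Ez = decidable-stable (z ∈? zs) λ z∉ →
    <⇒≱ (#-≥ (E? x y) {xs = allFin n} (¬Any⇒All¬ zs z∉ ∷ un) ∈-allFin (Ez ∷ Ezs)) d≤
    where open DecMembership Fin._≟_ using (_∈?_)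

  0<d : ∀ {x y z} → E x y z → 0 < d x y
  0<d {x} {y} e = #-≥ (E? x y) {xs = allFin n} ([] ∷ []) ∈-allFin (e ∷ [])

-- Edge deletion in 3-graphs

module _ {n : ℕ} where

  open Graph₃

  verts : List (Fin n)
  verts = allFin n

  Pair Triple : Set
  Pair   = Fin n × Fin n
  Triple = Fin n × Pair

  _≟ₚ_ : DecidableEquality Pair
  _≟ₚ_ = ≡-dec Fin._≟_ Fin._≟_

  _≟ₜ_ : DecidableEquality Triple
  _≟ₜ_ = ≡-dec Fin._≟_ _≟ₚ_

  open DecMembership _≟ₚ_ using () renaming (_∈?_ to _∈ₚ?_)
  open DecMembership _≟ₜ_ using () renaming (_∈?_ to _∈ₜ?_)

  pairs : List Pair
  pairs = cartesianProduct verts verts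

  pairs-unique : Unique pairs
  pairs-unique = cartesianProduct⁺ (allFin⁺ n) (allFin⁺ n)

  ∈-pairs : ∀ p → p ∈ pairs
  ∈-pairs (x , y) = ∈-cartesianProduct⁺ (∈-allFin x) (∈-allFin y)

  orbit : Triple → List Triple
  orbit (a , b , c) =
    (a , b , c) ∷ (a , c , b) ∷ (b , a , c) ∷ (b , c , a) ∷ (c , a , b) ∷ (c , b , a) ∷ []

  orbits : List Triple → List Triple
  orbits []       = []
  orbits (e ∷ es) = orbit e ++ orbits es

  orbits-closed : (σ : Triple → Triple) → (∀ e → All (λ t → σ t ∈ orbit e) (orbit e)) →
                  ∀ es {t} → t ∈ orbits es → σ t ∈ orbits es
  orbits-closed σ closed (e ∷ es) t∈ with ∈-++⁻ (orbit e) t∈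
  ... | inj₁ t∈e  = ∈-++⁺ˡ (All.lookup (closed e) t∈e)
  ... | inj₂ t∈es = ∈-++⁺ʳ (orbit e) (orbits-closed σ closed es t∈es)

  pattern 1st = here refl
  pattern 2nd = there (here refl)
  pattern 3rd = there (there (here refl))
  pattern 4th = there (there (there (here refl)))
  pattern 5th = there (there (there (there (here refl))))
  pattern 6th = there (there (there (there (there (here refl)))))

  orbits-swap₁₂ : ∀ es {x y z} → (x , y , z) ∈ orbits es → (y , x , z) ∈ orbits es
  orbits-swap₁₂ es = orbits-closed (λ (x , y , z) → y , x , z)
    (λ _ → 3rd ∷ 5th ∷ 1st ∷ 6th ∷ 2nd ∷ 4th ∷ []) es

  orbits-swap₂₃ : ∀ es {x y z} → (x , y , z) ∈ orbits es → (x , z , y) ∈ orbits es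
  orbits-swap₂₃ es = orbits-closed (λ (x , y , z) → x , z , y)
    (λ _ → 2nd ∷ 1st ∷ 4th ∷ 3rd ∷ 6th ∷ 5th ∷ []) es

  delete : Graph₃ n → List Triple → Graph₃ n
  delete G es = record
    { E      = λ x y z → E G x y z × ¬ ((x , y , z) ∈ orbits es)
    ; E?     = λ x y z → E? G x y z ×-dec ¬? ((x , y , z) ∈ₜ? orbits es)
    ; swap₁₂ = λ (e , ∉) → swap₁₂ G e , ∉ ∘ orbits-swap₁₂ es
    ; swap₂₃ = λ (e , ∉) → swap₂₃ G e , ∉ ∘ orbits-swap₂₃ es
    ; x≢y    = λ (e , _) → x≢y G e
    }

  -- `few` compares ordered counts: a deleted edge contributes six triples, a pair lost in both
  -- orders two entries. So 6 ≤ 3 · 2 is the balance of one edge against one pair, and under it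
  -- `Bounded` passes from `G′` back to `G`. `nonEmpty` makes the support decrease strictly.
  record Reduction (G : Graph₃ n) : Set where
    field
      deleted  : List Triple
      lost     : List Pair
      few      : length (orbits deleted) ≤ 3 * length lost
      nonEmpty : 0 < length lost
      distinct : Unique lost
      covered  : All (λ (a , b) → 0 < d G a b) lost
      isLost   : All (λ (a , b) → ∀ {z} → E G a b z → (a , b , z) ∈ orbits deleted) lost

    G′ : Graph₃ n
    G′ = delete G deleted

    open ≤-Reasoning

    size≤ : size G ≤ size G′ + length (orbits deleted)
    size≤ = begin
      size G
        ≤⟨ ∑-mono verts (λ x → ∑-mono verts (λ y → d≤ x y)) ⟩
      ∑[ x ∈ verts ] ∑[ y ∈ verts ] (d G′ x y + # (deleted? x y) verts)
        ≡⟨ ∑-cong verts (λ x → ∑-+ verts (d G′ x) _) ⟩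
      ∑[ x ∈ verts ] (∑[ y ∈ verts ] d G′ x y + ∑[ y ∈ verts ] # (deleted? x y) verts)
        ≡⟨ ∑-+ verts _ _ ⟩
      size G′ + ∑[ x ∈ verts ] ∑[ y ∈ verts ] # (deleted? x y) verts
        ≡⟨ cong (size G′ +_) (∑-cong verts (λ x → ∑-× verts verts (λ p → ⟦ (x , p) ∈ₜ? orbits deleted ⟧))) ⟨
      size G′ + ∑[ x ∈ verts ] ∑[ p ∈ pairs ] ⟦ (x , p) ∈ₜ? orbits deleted ⟧
        ≡⟨ cong (size G′ +_) (∑-× verts pairs (λ t → ⟦ t ∈ₜ? orbits deleted ⟧)) ⟨
      size G′ + # (_∈ₜ? orbits deleted) (cartesianProduct verts pairs)
        ≤⟨ +-monoʳ-≤ (size G′)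
             (#-≤ (_∈ₜ? orbits deleted) (cartesianProduct⁺ (allFin⁺ n) pairs-unique) _ (λ _ → id)) ⟩
      size G′ + length (orbits deleted) ∎
      where
      deleted? : ∀ x y z → Dec ((x , y , z) ∈ orbits deleted)
      deleted? x y z = (x , y , z) ∈ₜ? orbits deleted
      split : ∀ {x y z} → E G x y z → E G′ x y z ⊎ (x , y , z) ∈ orbits deleted
      split {x} {y} {z} e with (x , y , z) ∈ₜ? orbits deleted
      ... | yes ∈d = inj₂ ∈d
      ... | no  ∉d = inj₁ (e , ∉d)
      d≤ : ∀ x y → d G x y ≤ d G′ x y + # (deleted? x y) verts
      d≤ x y = ≤-trans
        (∑-mono verts (λ z → ⟦⟧-⊎ split (E? G x y z) (E? G′ x y z) (deleted? x y z)))
        (≤-reflexive (∑-+ verts _ _))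

    support≥ : support G′ + length lost ≤ support G
    support≥ = begin
      support G′ + length lost
        ≤⟨ +-monoʳ-≤ (support G′) (#-≥ (_∈ₚ? lost) distinct ∈-pairs (All.tabulate id)) ⟩
      support G′ + # (_∈ₚ? lost) pairs
        ≡⟨ cong (support G′ +_) (∑-× verts verts (λ p → ⟦ p ∈ₚ? lost ⟧)) ⟩
      support G′ + ∑[ x ∈ verts ] ∑[ y ∈ verts ] ⟦ (x , y) ∈ₚ? lost ⟧
        ≡⟨ ∑-+ verts _ _ ⟨
      ∑[ x ∈ verts ] (∑[ y ∈ verts ] pos (d G′ x y) + ∑[ y ∈ verts ] ⟦ (x , y) ∈ₚ? lost ⟧)
        ≡⟨ ∑-cong verts (λ x → ∑-+ verts _ _) ⟨
      ∑[ x ∈ verts ] ∑[ y ∈ verts ] (pos (d G′ x y) + ⟦ (x , y) ∈ₚ? lost ⟧)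
        ≤⟨ ∑-mono verts (λ x → ∑-mono verts (λ y → pos≤ x y)) ⟩
      support G ∎
      where
      pos≤ : ∀ x y → pos (d G′ x y) + ⟦ (x , y) ∈ₚ? lost ⟧ ≤ pos (d G x y)
      pos≤ x y with (x , y) ∈ₚ? lost
      ... | no _   = subst (_≤ pos (d G x y)) (sym (+-identityʳ (pos (d G′ x y))))
                       (pos-mono (#-mono (E? G′ x y) (E? G x y) verts (λ _ → proj₁)))
      -- A lost pair has degree 0 in `G′` and positive degree in `G`, so both sides equal 1.
      ... | yes ∈l = ≤-reflexive (trans
                       (cong (λ k → pos k + 1)
                         (#-none (E? G′ x y) verts (λ _ (e , ∉) → ∉ (All.lookup isLost ∈l e))))
                       (sym (0<⇒pos≡1 (All.lookup covered ∈l))))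

    support< : support G′ < support G
    support< = begin-strict
      support G′               <⟨ m<m+n (support G′) nonEmpty ⟩
      support G′ + length lost ≤⟨ support≥ ⟩
      support G                ∎

    lift-bound : Bounded G′ → Bounded G
    lift-bound bounded′ = begin
      size G                            ≤⟨ size≤ ⟩
      size G′ + length (orbits deleted) ≤⟨ +-mono-≤ bounded′ few ⟩
      3 * support G′ + 3 * length lost  ≡⟨ *-distribˡ-+ 3 (support G′) (length lost) ⟨
      3 * (support G′ + length lost)    ≤⟨ *-monoʳ-≤ 3 support≥ ⟩
      3 * support G                     ∎

  Irreducible : Graph₃ n → Set
  Irreducible G = ¬ Reduction G

  -- A counterexample of least support is irreducible. `Bounded` is decidable, so the argument runs
  -- by contradiction and it never has to be decided whether a reduction exists.
  irreducible-suffices : (Φ : Graph₃ n → Set) → (∀ {G} es → Φ G → Φ (delete G es)) →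
                         (∀ G → Φ G → Irreducible G → Bounded G) → ∀ G → Φ G → Bounded G
  irreducible-suffices Φ hereditary bound G φ = go G φ (<-wellFounded (support G))
    where
    go : ∀ G → Φ G → Acc _<_ (support G) → Bounded G
    go G φ (acc smaller) = decidable-stable (size G ≤? 3 * support G) λ ¬bounded →
      ¬bounded (bound G φ λ red → let open Reduction red in
        ¬bounded (lift-bound (go G′ (hereditary deleted φ) (smaller support<))))

  module _ (G : Graph₃ n) (irreducible : Irreducible G) where

    no-degree-1 : ∀ {a b c} → E G a b c → 1 < d G a b
    no-degree-1 {a} {b} {c} abc = ≰⇒> λ d≤1 →
      let only-c : ∀ {z} → E G a b z → z ∈ c ∷ []
          only-c = saturated G ([] ∷ []) (abc ∷ []) d≤1
      in irreducible record
        { deleted  = (a , b , c) ∷ []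
        ; lost     = (a , b) ∷ (b , a) ∷ []
        -- One edge against one pair: 6 = 3 · 2.
        ; few      = ≤-refl
        ; nonEmpty = s≤s z≤n
        ; distinct = ((λ { refl → x≢y G abc refl }) ∷ []) ∷ [] ∷ []
        ; covered  = 0<d G abc ∷ 0<d G (swap₁₂ G abc) ∷ []
        ; isLost   = (λ abz → case₁ (only-c abz)) ∷ (λ baz → case₂ (only-c (swap₁₂ G baz))) ∷ []
        }
      where
      case₁ : ∀ {z} → z ∈ c ∷ [] → (a , b , z) ∈ orbits ((a , b , c) ∷ [])
      case₁ 1st = 1st
      case₂ : ∀ {z} → z ∈ c ∷ [] → (b , a , z) ∈ orbits ((a , b , c) ∷ [])
      case₂ 1st = 3rd

    -- Each of the pairs xu, xy, xv lies in exactly two of the three edges and in no other edge.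
    -- Deleting the three edges therefore loses three pairs, again an exact balance: 18 = 3 · 6.
    no-book : ∀ {x u y v} → E G x u y → E G x u v → E G x y v →
              (∀ {z} → E G x u z → z ∈ y ∷ v ∷ []) → (∀ {z} → E G x y z → z ∈ u ∷ v ∷ []) →
              (∀ {z} → E G x v z → z ∈ u ∷ y ∷ []) → ⊥
    no-book {x} {u} {y} {v} xuy xuv xyv N-xu N-xy N-xv = irreducible record
      { deleted  = es
      ; lost     = (x , u) ∷ (u , x) ∷ (x , y) ∷ (y , x) ∷ (x , v) ∷ (v , x) ∷ []
      ; few      = ≤-refl
      ; nonEmpty = s≤s z≤n
      ; distinct =
          ((λ { refl → x≢u refl }) ∷ (λ { refl → u≢y refl }) ∷ (λ { refl → x≢y′ refl })
            ∷ (λ { refl → u≢v refl }) ∷ (λ { refl → x≢v refl }) ∷ [])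
        ∷ ((λ { refl → x≢u refl }) ∷ (λ { refl → u≢y refl })
            ∷ (λ { refl → x≢u refl }) ∷ (λ { refl → u≢v refl }) ∷ [])
        ∷ ((λ { refl → x≢y′ refl }) ∷ (λ { refl → y≢v refl }) ∷ (λ { refl → x≢v refl }) ∷ [])
        ∷ ((λ { refl → x≢y′ refl }) ∷ (λ { refl → y≢v refl }) ∷ [])
        ∷ ((λ { refl → x≢v refl }) ∷ [])
        ∷ [] ∷ []
      ; covered  = 0<d G xuy ∷ 0<d G (swap₁₂ G xuy) ∷ 0<d G xyv ∷ 0<d G (swap₁₂ G xyv)
                   ∷ 0<d G (swap₂₃ G xuv) ∷ 0<d G (swap₁₂ G (swap₂₃ G xuv)) ∷ []
      ; isLost   = (xu ∘ N-xu) ∷ (flip (xu ∘ N-xu)) ∷ (xy ∘ N-xy) ∷ (flip (xy ∘ N-xy))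
                   ∷ (xv ∘ N-xv) ∷ (flip (xv ∘ N-xv)) ∷ []
      }
      where
      es : List Triple
      es = (x , u , y) ∷ (x , u , v) ∷ (x , y , v) ∷ []
      x≢u = x≢y G xuy
      x≢y′ = x≢z G xuy
      x≢v = x≢z G xuv
      u≢y = y≢z G xuy
      u≢v = y≢z G xuv
      y≢v = y≢z G xyv
      6+ : ∀ {t} → t ∈ orbits ((x , u , v) ∷ (x , y , v) ∷ []) → t ∈ orbits es
      6+ = ∈-++⁺ʳ (orbit (x , u , y))
      12+ : ∀ {t} → t ∈ orbits ((x , y , v) ∷ []) → t ∈ orbits es
      12+ = 6+ ∘ ∈-++⁺ʳ (orbit (x , u , v))
      xu : ∀ {z} → z ∈ y ∷ v ∷ [] → (x , u , z) ∈ orbits es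
      xu 1st = 1st
      xu 2nd = 6+ 1st
      xy : ∀ {z} → z ∈ u ∷ v ∷ [] → (x , y , z) ∈ orbits es
      xy 1st = 2nd
      xy 2nd = 12+ 1st
      xv : ∀ {z} → z ∈ u ∷ y ∷ [] → (x , v , z) ∈ orbits es
      xv 1st = 6+ 2nd
      xv 2nd = 12+ 2nd
      flip : ∀ {a b} → (∀ {z} → E G a b z → (a , b , z) ∈ orbits es) →
             ∀ {z} → E G b a z → (b , a , z) ∈ orbits es
      flip f baz = orbits-swap₁₂ es (f (swap₁₂ G baz))

  StarFree TightPathFree : Graph₃ n → Set
  StarFree G = ∀ {a b c p q w} → Unique (a ∷ b ∷ c ∷ p ∷ q ∷ w ∷ []) →
    E G a b c → E G b c p → E G a c q → E G a b w → ⊥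
  TightPathFree G = ∀ {p u y x v q} → Unique (p ∷ u ∷ y ∷ x ∷ v ∷ q ∷ []) →
    E G p u y → E G u y x → E G y x v → E G x v q → ⊥

  -- The triple star

  module _ (G : Graph₃ n) (free : StarFree G) (irreducible : Irreducible G) where

    -- The greedy embedding of the star around abc needs degrees 2, 3, 4 on its facets, since the
    -- third vertex of abc and all earlier choices must be avoided. Irreducibility provides 2 on bc
    -- and the high facet provides 4 on ab, so ac cannot have 3.
    low-facet : ∀ {a b c} → E G a b c → 3 < d G a b → d G a c ≤ 2
    low-facet {a} {b} {c} abc 3<d = ≮⇒≥ λ 2<d →
      let bca = swap₂₃ G (swap₁₂ G abc)
          p , bcp , p≢a , _                = pickFin (E? G b c) (a ∷ []) (no-degree-1 G irreducible bca)
          q , acq , q≢b , q≢p , _         = pickFin (E? G a c) (b ∷ p ∷ []) 2<d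
          w , abw , w≢c , w≢p , w≢q , _ = pickFin (E? G a b) (c ∷ p ∷ q ∷ []) 3<d
      in free
        ( (x≢y G abc ∷ x≢z G abc ∷ ≢-sym p≢a ∷ x≢z G acq ∷ x≢z G abw ∷ [])
        ∷ (y≢z G abc ∷ x≢z G bcp ∷ ≢-sym q≢b ∷ y≢z G abw ∷ [])
        ∷ (y≢z G bcp ∷ y≢z G acq ∷ ≢-sym w≢c ∷ [])
        ∷ (≢-sym q≢p ∷ ≢-sym w≢p ∷ [])
        ∷ (≢-sym w≢q ∷ []) ∷ [] ∷ [])
        abc bcp acq abw

    -- In each of its two edges a facet of degree 2 pays 1 to the high facet (degree ≥ 4), which is unique
    -- by low-facet; all charges are doubled.
    star-free-irreducible : Bounded G
    star-free-irreducible = *-cancelˡ-≤ 2 (+-cancelʳ-≤ (2 * S) (2 * size G) (2 * (3 * support G)) (begin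
      2 * size G + 2 * S
        ≡⟨ cong₂ _+_ (∑∑-* 2 (d G)) 2S ⟨
      ∑[ x ∈ verts ] ∑[ y ∈ verts ] (2 * d G x y) + ∑[ x ∈ verts ] ∑[ y ∈ verts ] paid x y
        ≡⟨ ∑∑-+ _ paid ⟨
      ∑[ x ∈ verts ] ∑[ y ∈ verts ] (2 * d G x y + paid x y)
        ≤⟨ ∑-mono verts (λ x → ∑-mono verts (λ y → local x y)) ⟩
      ∑[ x ∈ verts ] ∑[ y ∈ verts ] (6 * pos (d G x y) + 2 * received x y)
        ≡⟨ ∑∑-+ _ _ ⟩
      ∑[ x ∈ verts ] ∑[ y ∈ verts ] (6 * pos (d G x y)) + ∑[ x ∈ verts ] ∑[ y ∈ verts ] (2 * received x y)
        ≡⟨ cong₂ _+_ (∑∑-* 6 _) (∑∑-* 2 received) ⟩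
      6 * support G + 2 * S
        ≡⟨ cong (_+ 2 * S) (*-assoc 2 3 (support G)) ⟩
      2 * (3 * support G) + 2 * S ∎))
      where
      open ≤-Reasoning
      g? : ∀ x y z → Dec (E G x y z × 3 < d G x y)
      g? x y z = E? G x y z ×-dec (3 <? d G x y)
      received paid : Fin n → Fin n → ℕ
      received x y = # (g? x y) verts
      -- Within the edge x y z the facet x y may pay to x z or to y z.
      paid x y = ∑[ z ∈ verts ] (⟦ g? x z y ⟧ + ⟦ g? y z x ⟧)
      S : ℕ
      S = ∑[ x ∈ verts ] ∑[ y ∈ verts ] received x y
      ∑∑-+ : ∀ (f f′ : Fin n → Fin n → ℕ) → ∑[ x ∈ verts ] ∑[ y ∈ verts ] (f x y + f′ x y) ≡
             ∑[ x ∈ verts ] ∑[ y ∈ verts ] f x y + ∑[ x ∈ verts ] ∑[ y ∈ verts ] f′ x y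
      ∑∑-+ f f′ = trans (∑-cong verts (λ x → ∑-+ verts (f x) (f′ x))) (∑-+ verts _ _)
      ∑∑-* : ∀ c (f : Fin n → Fin n → ℕ) → ∑[ x ∈ verts ] ∑[ y ∈ verts ] (c * f x y) ≡ c * ∑[ x ∈ verts ] ∑[ y ∈ verts ] f x y
      ∑∑-* c f = trans (∑-cong verts (λ x → ∑-* verts c (f x))) (∑-* verts c _)
      2S : ∑[ x ∈ verts ] ∑[ y ∈ verts ] paid x y ≡ 2 * S
      2S = begin-equality
        ∑[ x ∈ verts ] ∑[ y ∈ verts ] paid x y
          ≡⟨ ∑-cong verts (λ x → ∑-cong verts (λ y → ∑-+ verts _ _)) ⟩
        ∑[ x ∈ verts ] ∑[ y ∈ verts ] (∑[ z ∈ verts ] ⟦ g? x z y ⟧ + ∑[ z ∈ verts ] ⟦ g? y z x ⟧)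
          ≡⟨ ∑∑-+ _ _ ⟩
        ∑[ x ∈ verts ] ∑[ y ∈ verts ] ∑[ z ∈ verts ] ⟦ g? x z y ⟧ + ∑[ x ∈ verts ] ∑[ y ∈ verts ] ∑[ z ∈ verts ] ⟦ g? y z x ⟧
          -- Reordering the summations puts the high facet first in both terms: each edge at a high
          -- facet is paid for by its two other facets.
          ≡⟨ cong₂ _+_ (∑-cong verts (λ x → ∑-comm verts verts _)) (trans (∑-comm verts verts _) (∑-cong verts (λ x → ∑-comm verts verts _))) ⟩
        S + S
          ≡⟨ cong (S +_) (+-identityʳ S) ⟨
        2 * S ∎
      low₁ : ∀ {x y z} → E G x z y × 3 < d G x z → d G x y ≤ 2
      low₁ (e , high) = low-facet e high
      low₂ : ∀ {x y z} → E G y z x × 3 < d G y z → d G x y ≤ 2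
      low₂ {x} {y} g = subst (_≤ 2) (d-sym G y x) (low₁ g)
      local : ∀ x y → 2 * d G x y + paid x y ≤ 6 * pos (d G x y) + 2 * received x y
      local x y with d G x y ≤? 2
      ... | yes d≤2 = begin
        2 * d G x y + paid x y                 ≤⟨ +-monoʳ-≤ (2 * d G x y) paid≤ ⟩
        2 * d G x y + d G x y                  ≡⟨ +-comm (2 * d G x y) (d G x y) ⟩
        3 * d G x y                            ≤⟨ 3d≤6pos d≤2 ⟩
        6 * pos (d G x y)                      ≤⟨ m≤m+n _ _ ⟩
        6 * pos (d G x y) + 2 * received x y   ∎
        where
        3d≤6pos : ∀ {k} → k ≤ 2 → 3 * k ≤ 6 * pos k
        3d≤6pos {zero}  _   = z≤n
        3d≤6pos {suc k} k≤2 = *-monoʳ-≤ 3 k≤2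
        paid≤ : paid x y ≤ d G x y
        -- At most one payment per edge: if x z is high, `low-facet` bounds the degree of z y by 2,
        -- so y z is not high.
        paid≤ = ∑-mono verts λ z → ⟦⟧-disjoint (swap₂₃ G ∘ proj₁) (swap₁₂ G ∘ swap₂₃ G ∘ proj₁)
          (λ (xzy , high) (_ , high′) →
            <⇒≱ (subst (3 <_) (d-sym G y z) high′)
                (m≤n⇒m≤1+n (low-facet (swap₁₂ G xzy) (subst (3 <_) (d-sym G x z) high))))
          (g? x z y) (g? y z x) (E? G x y z)
      ... | no d≰2 = begin
        2 * d G x y + paid x y                 ≡⟨ cong (2 * d G x y +_) paid≡0 ⟩
        2 * d G x y + 0                        ≡⟨ +-identityʳ (2 * d G x y) ⟩
        2 * d G x y                            ≤⟨ 2d≤ ⟩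
        6 * pos (d G x y) + 2 * received x y   ∎
        where
        paid≡0 : paid x y ≡ 0
        paid≡0 = trans
          (∑-cong verts λ z → cong₂ _+_ (⟦⟧-no (g? x z y) (d≰2 ∘ low₁)) (⟦⟧-no (g? y z x) (d≰2 ∘ low₂)))
          (∑-zero verts)
        2d≤ : 2 * d G x y ≤ 6 * pos (d G x y) + 2 * received x y
        2d≤ with d G x y ≤? 3
        ... | yes d≤3 = begin
          2 * d G x y                          ≤⟨ *-monoʳ-≤ 2 d≤3 ⟩
          6                                    ≡⟨ cong (6 *_) (0<⇒pos≡1 (≤-trans (s≤s z≤n) (≰⇒> d≰2))) ⟨
          6 * pos (d G x y)                    ≤⟨ m≤m+n _ _ ⟩
          6 * pos (d G x y) + 2 * received x y ∎
        ... | no d≰3 = begin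
          2 * d G x y                          ≤⟨ *-monoʳ-≤ 2 (#-mono _ (g? x y) verts (λ _ xyz → xyz , ≰⇒> d≰3)) ⟩
          2 * received x y                     ≤⟨ m≤n+m (2 * received x y) (6 * pos (d G x y)) ⟩
          6 * pos (d G x y) + 2 * received x y ∎

  star-free : ∀ G → StarFree G → Bounded G
  star-free = irreducible-suffices StarFree
    (λ _ free un (e₁ , _) (e₂ , _) (e₃ , _) (e₄ , _) → free un e₁ e₂ e₃ e₄)
    (λ G free irr → star-free-irreducible G free irr)

  -- The tight path with four edges

  module _ (G : Graph₃ n) (free : TightPathFree G) (irreducible : Irreducible G) where

    -- A neighbour q of xv outside {u, y} would end a tight path uyx, yxv, xvq, and degree 4 of uy
    -- still leaves a vertex p off x, v, q to start it with puy.
    opposite-facet : ∀ {u y x v} → 3 < d G u y → E G u y x → E G x y v → v ≢ u →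
                     ∀ {q} → E G x v q → q ∈ u ∷ y ∷ []
    opposite-facet {u} {y} {x} {v} 3<d uyx xyv v≢u {q} xvq with q Fin.≟ u | q Fin.≟ y
    ... | yes refl | _        = 1st
    ... | no _     | yes refl = 2nd
    ... | no q≢u   | no q≢y =
      let p , uyp , p≢x , p≢v , p≢q , _ = pickFin (E? G u y) (x ∷ v ∷ q ∷ []) 3<d
      in ⊥-elim (free
        ( (≢-sym (x≢z G uyp) ∷ ≢-sym (y≢z G uyp) ∷ p≢x ∷ p≢v ∷ p≢q ∷ [])
        ∷ (x≢y G uyx ∷ x≢z G uyx ∷ ≢-sym v≢u ∷ ≢-sym q≢u ∷ [])
        ∷ (y≢z G uyx ∷ y≢z G xyv ∷ ≢-sym q≢y ∷ [])
        ∷ (x≢z G xyv ∷ x≢z G xvq ∷ [])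
        ∷ (y≢z G xvq ∷ []) ∷ [] ∷ [])
        (swap₁₂ G (swap₂₃ G uyp)) uyx (swap₁₂ G xyv) xvq)

    -- The pair xv has no neighbours outside {u, y} but, by irreducibility, at least two; so u is
    -- one of them.
    opposite-edge : ∀ {u y x v} → 3 < d G u y → E G u y x → E G x y v → v ≢ u → E G x v u
    opposite-edge {u} {y} {x} {v} 3<d uyx xyv v≢u
      with z , xvz , z≢y , _ ← pickFin (E? G x v) (y ∷ []) (no-degree-1 G irreducible (swap₂₃ G xyv))
      with opposite-facet 3<d uyx xyv v≢u xvz
    ... | 1st = xvz
    ... | 2nd = contradiction refl z≢y

    -- Otherwise xy has exactly two neighbours u and v. Then the neighbourhoods of xu and xv are
    -- also confined to {u, y, v}, which is the configuration excluded by `no-book`.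
    degree≥3 : ∀ {u y x} → 3 < d G u y → E G u y x → 2 < d G x y
    degree≥3 {u} {y} {x} 3<d uyx = ≰⇒> λ d≤2 →
      let xyu = swap₁₂ G (swap₂₃ G (swap₁₂ G uyx))
          xuy = swap₂₃ G xyu
          yux = swap₁₂ G uyx
          3<d′ = subst (3 <_) (d-sym G u y) 3<d
          v , xyv , v≢u , _ = pickFin (E? G x y) (u ∷ []) (no-degree-1 G irreducible xyu)
          xuv = swap₂₃ G (opposite-edge 3<d uyx xyv v≢u)
          N-xy : ∀ {z} → E G x y z → z ∈ u ∷ v ∷ []
          N-xy = saturated G ((≢-sym v≢u ∷ []) ∷ [] ∷ []) (xyu ∷ xyv ∷ []) d≤2
      in no-book G irreducible xuy xuv xyv
           (λ {z} → N-xu N-xy 3<d′ yux xuy) N-xy (opposite-facet 3<d uyx xyv v≢u)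
      where
      -- `opposite-edge` with u and y interchanged turns a neighbour z ≠ y of xu into a neighbour of
      -- xy, hence into v.
      N-xu : ∀ {v} → (∀ {z} → E G x y z → z ∈ u ∷ v ∷ []) → 3 < d G y u → E G y u x → E G x u y →
             ∀ {z} → E G x u z → z ∈ y ∷ v ∷ []
      N-xu N-xy 3<d′ yux xuy {z} xuz with z Fin.≟ y
      ... | yes refl = 1st
      ... | no z≢y with N-xy (swap₂₃ G (opposite-edge 3<d′ yux xuz z≢y))
      ...   | 1st = contradiction refl (y≢z G xuz)
      ...   | 2nd = 2nd

    -- The high facet u y (degree ≥ 4) receives 1 from each facet x v with neighbourhood {u, y};
    -- all charges are doubled and run over ordered pairs.
    tight-path-free-irreducible : Bounded G
    tight-path-free-irreducible = *-cancelˡ-≤ 2 (begin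
      2 * size G                          ≡⟨ cong (2 *_) (∑-× verts verts (λ (x , y) → d G x y)) ⟨
      2 * ∑ pairs deg                     ≡⟨ ∑-* pairs 2 deg ⟨
      ∑[ e ∈ pairs ] (2 * deg e)          ≤⟨ discharging pairs _ _ (λ e f → ⟦ h? e f ⟧) local ⟩
      ∑[ e ∈ pairs ] (6 * pos (deg e))    ≡⟨ ∑-* pairs 6 (pos ∘ deg) ⟩
      6 * ∑ pairs (pos ∘ deg)             ≡⟨ cong (6 *_) (∑-× verts verts (λ (x , y) → pos (d G x y))) ⟩
      6 * support G                       ≡⟨ *-assoc 2 3 (support G) ⟩
      2 * (3 * support G)                 ∎)
      where
      open ≤-Reasoning
      deg : Pair → ℕ
      deg (x , y) = d G x y
      -- The first pair receives from the second. By `only-opposite` the payer has neighbourhood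
      -- exactly {u, y}.
      H : Pair → Pair → Set
      H (u , y) (x , v) = 3 < d G u y × E G u y x × E G x v u × E G x v y
      h? : ∀ e f → Dec (H e f)
      h? (u , y) (x , v) = (3 <? d G u y) ×-dec E? G u y x ×-dec E? G x v u ×-dec E? G x v y
      only-opposite : ∀ {u y x v} → H (u , y) (x , v) → ∀ {q} → E G x v q → q ∈ u ∷ y ∷ []
      only-opposite (3<d , uyx , xvu , xvy) = opposite-facet 3<d uyx (swap₂₃ G xvy) (y≢z G xvu)
      received≥ : ∀ u y → 3 < d G u y → 2 * d G u y ≤ # (h? (u , y)) pairs
      received≥ u y 3<d = begin
        2 * d G u y                                       ≡⟨ ∑-* verts 2 _ ⟨
        ∑[ x ∈ verts ] (2 * ⟦ E? G u y x ⟧)                    ≤⟨ ∑-mono verts (λ x → two x (E? G u y x)) ⟩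
        ∑[ x ∈ verts ] # (λ v → h? (u , y) (x , v)) verts          ≡⟨ ∑-× verts verts (λ f → ⟦ h? (u , y) f ⟧) ⟨
        # (h? (u , y)) pairs                               ∎
        where
        -- `degree≥3` gives xy two neighbours v, w other than u, hence two payers xv, xw for each
        -- edge uyx. A high pair thus receives its entire doubled degree.
        two : ∀ x (uyx? : Dec (E G u y x)) → 2 * ⟦ uyx? ⟧ ≤ # (λ v → h? (u , y) (x , v)) verts
        two x (no _)    = z≤n
        two x (yes uyx) =
          let 2<d = degree≥3 3<d uyx
              v , xyv , v≢u , _         = pickFin (E? G x y) (u ∷ []) (<⇒≤ 2<d)
              w , xyw , w≢u , w≢v , _ = pickFin (E? G x y) (u ∷ v ∷ []) 2<d
          in #-≥ (λ v → h? (u , y) (x , v)) {xs = verts} ((≢-sym w≢v ∷ []) ∷ [] ∷ []) ∈-allFin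
               ( (3<d , uyx , opposite-edge 3<d uyx xyv v≢u , swap₂₃ G xyv)
               ∷ (3<d , uyx , opposite-edge 3<d uyx xyw w≢u , swap₂₃ G xyw) ∷ [])
      local : ∀ e → 2 * deg e + # (λ f → h? f e) pairs ≤ 6 * pos (deg e) + # (h? e) pairs
      local e@(x , v) with 0 <? # (λ f → h? f e) pairs
      ... | yes 0<paid = paying (pick (λ f → h? f e) _≟ₚ_ pairs-unique [] 0<paid)
        where
        paying : ∃[ f ] H f e × All (f ≢_) [] → _
        paying (f@(u , y) , h@(_ , uyx , xvu , _) , _) = begin
          2 * deg e + # (λ f → h? f e) pairs ≤⟨ +-mono-≤ (*-monoʳ-≤ 2 d≤2) paid≤2 ⟩
          6                                  ≡⟨ cong (6 *_) (0<⇒pos≡1 (0<d G xvu)) ⟨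
          6 * pos (deg e)                    ≤⟨ m≤m+n _ _ ⟩
          6 * pos (deg e) + # (h? e) pairs   ∎
          where
          d≤2 : deg e ≤ 2
          d≤2 = #-≤ (E? G x v) (allFin⁺ n) (u ∷ y ∷ []) (λ _ → only-opposite h)
          -- The neighbourhood of the payer determines the receiver up to order. So it pays at most
          -- 2 and ends at 2 · 2 + 2 = 6.
          f-or-swapped : ∀ g → H g e → g ∈ (u , y) ∷ (y , u) ∷ []
          f-or-swapped (u′ , y′) (_ , u′y′x , xvu′ , xvy′)
            with only-opposite h xvu′ | only-opposite h xvy′
          ... | 1st | 1st = contradiction refl (x≢y G u′y′x)
          ... | 1st | 2nd = 1st
          ... | 2nd | 1st = 2nd
          ... | 2nd | 2nd = contradiction refl (x≢y G u′y′x)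
          paid≤2 : # (λ f → h? f e) pairs ≤ 2
          paid≤2 = #-≤ (λ f → h? f e) pairs-unique ((u , y) ∷ (y , u) ∷ []) f-or-swapped
      ... | no 0≮paid = begin
        2 * deg e + # (λ f → h? f e) pairs ≡⟨ cong (2 * deg e +_) (n≤0⇒n≡0 (≮⇒≥ 0≮paid)) ⟩
        2 * deg e + 0                      ≡⟨ +-identityʳ (2 * deg e) ⟩
        2 * deg e                          ≤⟨ 2d≤ ⟩
        6 * pos (deg e) + # (h? e) pairs   ∎
        where
        2d≤6pos : ∀ {k} → k ≤ 3 → 2 * k ≤ 6 * pos k
        2d≤6pos {zero}  _   = z≤n
        2d≤6pos {suc k} k≤3 = *-monoʳ-≤ 2 k≤3
        2d≤ : 2 * deg e ≤ 6 * pos (deg e) + # (h? e) pairs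
        2d≤ with deg e ≤? 3
        ... | yes d≤3 = ≤-trans (2d≤6pos d≤3) (m≤m+n _ _)
        ... | no  d≰3 = ≤-trans (received≥ x v (≰⇒> d≰3)) (m≤n+m (# (h? e) pairs) (6 * pos (deg e)))

  tight-path-free : ∀ G → TightPathFree G → Bounded G
  tight-path-free = irreducible-suffices TightPathFree
    (λ _ free un (e₁ , _) (e₂ , _) (e₃ , _) (e₄ , _) → free un e₁ e₂ e₃ e₄)
    (λ G free irr → tight-path-free-irreducible G free irr)

-- Links

infixl 6 _⊕_ _⊖_

_⊕_ _⊖_ : Subset n → Fin n → Subset n
S ⊕ x = S [ x ]≔ inside
S ⊖ x = S [ x ]≔ outside

x∈S⊕x : ∀ (S : Subset n) x → x ∈ₛ S ⊕ x
x∈S⊕x = []≔-updates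

∈-⊕⁺ : ∀ {S : Subset n} {x y} → y ∈ₛ S → y ∈ₛ S ⊕ x
∈-⊕⁺ {S = S} {x} {y} y∈S with y Fin.≟ x
... | yes refl = x∈S⊕x S x
... | no y≢x   = []≔-minimal S y x y≢x y∈S

∈-⊕⁻ : ∀ {S : Subset n} {x y} → y ∈ₛ S ⊕ x → y ≡ x ⊎ y ∈ₛ S
∈-⊕⁻ {S = S} {x} {y} y∈ with y Fin.≟ x
... | yes y≡x = inj₁ y≡x
... | no y≢x  = inj₂ (lookup⇒[]= y S (trans (sym (lookup∘update′ y≢x S inside)) ([]=⇒lookup y∈)))

∉-⊕⁻ : ∀ {S : Subset n} {x y} → y ∉ₛ S ⊕ x → x ≢ y × y ∉ₛ S
∉-⊕⁻ {S = S} {x} y∉ = (λ { refl → y∉ (x∈S⊕x S x) }) , y∉ ∘ ∈-⊕⁺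

∉-⊕⁺ : ∀ {S : Subset n} {x y} → y ≢ x → y ∉ₛ S → y ∉ₛ S ⊕ x
∉-⊕⁺ y≢x y∉S y∈ = [ y≢x , y∉S ]′ (∈-⊕⁻ y∈)

⊕-comm : ∀ (S : Subset n) x y → S ⊕ x ⊕ y ≡ S ⊕ y ⊕ x
⊕-comm S x y with x Fin.≟ y
... | yes refl = refl
... | no x≢y   = []≔-commutes S x y x≢y

∣S⊕x∣ : ∀ {S : Subset n} {x} → x ∉ₛ S → ∣ S ⊕ x ∣ ≡ suc ∣ S ∣
∣S⊕x∣ {S = inside  ∷ S} {zero}  x∉ = contradiction Vec.here x∉
∣S⊕x∣ {S = outside ∷ S} {zero}  x∉ = refl
∣S⊕x∣ {S = inside  ∷ S} {suc x} x∉ = cong suc (∣S⊕x∣ (x∉ ∘ Vec.there))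
∣S⊕x∣ {S = outside ∷ S} {suc x} x∉ = ∣S⊕x∣ (x∉ ∘ Vec.there)

⟦⟧-× : {P Q : Set} (p : Dec P) (q : Dec Q) → ⟦ p ×-dec q ⟧ ≡ ⟦ p ⟧ * ⟦ q ⟧
⟦⟧-× (no _)  q       = refl
⟦⟧-× (yes _) (yes _) = refl
⟦⟧-× (yes _) (no _)  = refl

pos-⟦⟧* : {P : Set} (p : Dec P) (k : ℕ) → pos (⟦ p ⟧ * k) ≡ ⟦ p ⟧ * pos k
pos-⟦⟧* (no _)  k = refl
pos-⟦⟧* (yes _) k = trans (cong pos (+-identityʳ k)) (sym (+-identityʳ (pos k)))

_∉ₛ?_ : ∀ x (S : Subset n) → Dec (x ∉ₛ S)
x ∉ₛ? S = ¬? (x ∈ₛ? S)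

-- Summation over the sets covering `S`. The degree `D` is `extend` of the edge indicator, and
-- degree sums in links are iterated extensions of `D`.
extend : (Subset n → ℕ) → Subset n → ℕ
extend F S = ∑[ x ∈ allFin _ ] (⟦ x ∉ₛ? S ⟧ * F (S ⊕ x))

∑-suc : (f : Fin (suc n) → ℕ) → ∑ (allFin (suc n)) f ≡ f zero + ∑ (allFin _) (f ∘ suc)
∑-suc f = cong (f zero +_)
  (trans (cong (λ xs → ∑ xs f) (sym (map-tabulate id suc))) (∑-map suc (allFin _) f))

∑-subsets-suc : (F : Subset (suc n) → ℕ) →
  ∑ (subsets (suc n)) F ≡ ∑[ S ∈ subsets n ] F (outside ∷ S) + ∑[ S ∈ subsets n ] F (inside ∷ S)
∑-subsets-suc F = trans (∑-++ (map (outside ∷_) (subsets _)) _ F)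
  (cong₂ _+_ (∑-map (outside ∷_) (subsets _) F) (∑-map (inside ∷_) (subsets _) F))

-- Each set S arises from its |S| subsets S − x.
∑-extend : ∀ n (F : Subset n → ℕ) → ∑ (subsets n) (extend F) ≡ ∑[ S ∈ subsets n ] (∣ S ∣ * F S)
∑-extend zero    F = refl
∑-extend (suc n) F = begin
  ∑ (subsets (suc n)) (extend F)
    ≡⟨ ∑-subsets-suc (extend F) ⟩
  ∑[ S ∈ subsets n ] extend F (outside ∷ S) + ∑[ S ∈ subsets n ] extend F (inside ∷ S)
    ≡⟨ cong₂ _+_ (∑-cong (subsets n) outside-step) (∑-cong (subsets n) inside-step) ⟩
  ∑[ S ∈ subsets n ] (F (inside ∷ S) + extend (F ∘ (outside ∷_)) S) +
    ∑[ S ∈ subsets n ] extend (F ∘ (inside ∷_)) S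
    ≡⟨ cong (_+ ∑ (subsets n) (extend (F ∘ (inside ∷_)))) (∑-+ (subsets n) _ _) ⟩
  ∑ (subsets n) (F ∘ (inside ∷_)) + ∑ (subsets n) (extend (F ∘ (outside ∷_))) +
    ∑ (subsets n) (extend (F ∘ (inside ∷_)))
    ≡⟨ cong₂ (λ a b → ∑ (subsets n) (F ∘ (inside ∷_)) + a + b) (∑-extend n _) (∑-extend n _) ⟩
  ∑ (subsets n) (F ∘ (inside ∷_)) + out + inn
    ≡⟨ cong (_+ inn) (+-comm (∑ (subsets n) (F ∘ (inside ∷_))) out) ⟩
  out + ∑ (subsets n) (F ∘ (inside ∷_)) + inn
    ≡⟨ +-assoc out _ inn ⟩
  out + (∑ (subsets n) (F ∘ (inside ∷_)) + inn)
    ≡⟨ cong (out +_) (∑-+ (subsets n) _ _) ⟨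
  out + ∑[ S ∈ subsets n ] (suc ∣ S ∣ * F (inside ∷ S))
    ≡⟨ ∑-subsets-suc (λ S → ∣ S ∣ * F S) ⟨
  ∑[ S ∈ subsets (suc n) ] (∣ S ∣ * F S) ∎
  where
  open ≡-Reasoning
  out inn : ℕ
  out = ∑[ S ∈ subsets n ] (∣ S ∣ * F (outside ∷ S))
  inn = ∑[ S ∈ subsets n ] (∣ S ∣ * F (inside ∷ S))
  there-step : ∀ b (S : Subset n) x → ⟦ suc x ∉ₛ? (b ∷ S) ⟧ * F ((b ∷ S) ⊕ suc x) ≡ ⟦ x ∉ₛ? S ⟧ * F (b ∷ (S ⊕ x))
  there-step b S x = cong (_* F (b ∷ (S ⊕ x)))
    (⟦⟧-cong (λ ∉ → ∉ ∘ Vec.there) (λ { ∉ (Vec.there x∈) → ∉ x∈ }) (suc x ∉ₛ? (b ∷ S)) (x ∉ₛ? S))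
  outside-step : ∀ S → extend F (outside ∷ S) ≡ F (inside ∷ S) + extend (F ∘ (outside ∷_)) S
  outside-step S = trans (∑-suc (λ x → ⟦ x ∉ₛ? (outside ∷ S) ⟧ * F ((outside ∷ S) ⊕ x)))
    (cong₂ _+_ (+-identityʳ _) (∑-cong (allFin _) (there-step outside S)))
  inside-step : ∀ S → extend F (inside ∷ S) ≡ extend (F ∘ (inside ∷_)) S
  inside-step S = trans (∑-suc (λ x → ⟦ x ∉ₛ? (inside ∷ S) ⟧ * F ((inside ∷ S) ⊕ x))) (∑-cong (allFin _) (there-step inside S))

-- With weight on `k`-sets only, sums can run over all subsets, and the factor `∣ S ∣` in `∑-extend`
-- becomes the constant `k`.
Supported : ℕ → (Subset n → ℕ) → Set
Supported k F = ∀ S → 0 < F S → ∣ S ∣ ≡ k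

∑-extend-supported : ∀ {k} {F : Subset n → ℕ} → Supported k F →
                     ∑ (subsets n) (extend F) ≡ k * ∑ (subsets n) F
∑-extend-supported {n} {k} {F} supp =
  trans (∑-extend n F) (trans (∑-cong (subsets n) weight) (∑-* (subsets n) k F))
  where
  weight : ∀ S → ∣ S ∣ * F S ≡ k * F S
  weight S with F S | supp S
  ... | zero  | _      = trans (*-zeroʳ ∣ S ∣) (sym (*-zeroʳ k))
  ... | suc a | ∣S∣≡k = cong (_* suc a) (∣S∣≡k (s≤s z≤n))

∑-positive : (xs : List A) (f : A → ℕ) → 0 < ∑ xs f → ∃[ x ] 0 < f x
∑-positive (x ∷ xs) f 0<∑ with f x in eq
... | suc a = x , subst (0 <_) (sym eq) (s≤s z≤n)
... | zero  = ∑-positive xs f 0<∑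

extend-supported : ∀ {k} {F : Subset n → ℕ} → Supported (suc k) F → Supported k (extend F)
extend-supported {n} {k} {F} supp S 0<
  with x , 0<x ← ∑-positive (allFin _) _ 0< with x ∉ₛ? S
... | yes x∉S = suc-injective (trans (sym (∣S⊕x∣ x∉S)) (supp (S ⊕ x) (subst (0 <_) (+-identityʳ _) 0<x)))

-- This is the averaging over links: extension multiplies both totals by the same positive factor
-- `suc k`.
extend-cancel : ∀ c {k} {F F′ : Subset n → ℕ} → Supported (suc k) F → Supported (suc k) F′ →
                ∑ (subsets n) (extend F) ≤ c * ∑ (subsets n) (extend F′) →
                ∑ (subsets n) F ≤ c * ∑ (subsets n) F′
extend-cancel {n} c {k} {F} {F′} supp supp′ le = *-cancelˡ-≤ (suc k) (begin
  suc k * ∑ (subsets n) F                ≡⟨ ∑-extend-supported supp ⟨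
  ∑ (subsets n) (extend F)               ≤⟨ le ⟩
  c * ∑ (subsets n) (extend F′)          ≡⟨ cong (c *_) (∑-extend-supported supp′) ⟩
  c * (suc k * ∑ (subsets n) F′)         ≡⟨ x∙yz≈y∙xz *-commutativeSemigroup c (suc k) _ ⟩
  suc k * (c * ∑ (subsets n) F′)         ∎)
  where
  open ≤-Reasoning

module Link {n : ℕ} {P : Subset n → Set} (P? : Decidable P) where

  -- In the iterates each vertex must be new to the set built so far, so distinctness of the
  -- vertices is built into `Link₂` and `Link₃`.
  Link₁ : (Subset n → Set) → Subset n → Fin n → Set
  Link₁ Q R x = x ∉ₛ R × Q (R ⊕ x)

  Link₂ : (Subset n → Set) → Subset n → Fin n → Fin n → Set
  Link₂ Q R x y = Link₁ (λ S → Link₁ Q S y) R x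

  Link₃ : (Subset n → Set) → Subset n → Fin n → Fin n → Fin n → Set
  Link₃ Q R x y z = Link₁ (λ S → Link₂ Q S y z) R x

  link₁? : ∀ {Q} → Decidable Q → ∀ R x → Dec (Link₁ Q R x)
  link₁? Q? R x = (x ∉ₛ? R) ×-dec Q? (R ⊕ x)

  link₂? : ∀ R x y → Dec (Link₂ P R x y)
  link₂? R x y = link₁? (λ S → link₁? P? S y) R x

  link₃? : ∀ R x y z → Dec (Link₃ P R x y z)
  link₃? R x y z = link₁? (λ S → link₂? S y z) R x

  link₂-swap : ∀ {Q R x y} → Link₂ Q R x y → Link₂ Q R y x
  link₂-swap {Q} {R} {x} {y} (x∉R , y∉ , q) =
    let x≢y , y∉R = ∉-⊕⁻ y∉ in y∉R , ∉-⊕⁺ x≢y x∉R , subst Q (⊕-comm R x y) q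

  D : Subset n → ℕ
  D S = # (link₁? P? S) (allFin n)

  D≡extend : ∀ S → D S ≡ extend (λ S → ⟦ P? S ⟧) S
  D≡extend S = ∑-cong (allFin n) (λ x → ⟦⟧-× (x ∉ₛ? S) (P? (S ⊕ x)))

  #link₁ : ∀ {Q : Subset n → Fin n → Set} (Q? : ∀ S y → Dec (Q S y)) R x →
           # (λ y → link₁? (λ S → Q? S y) R x) (allFin n) ≡ ⟦ x ∉ₛ? R ⟧ * # (Q? (R ⊕ x)) (allFin n)
  #link₁ Q? R x = trans (∑-cong (allFin n) (λ y → ⟦⟧-× (x ∉ₛ? R) (Q? (R ⊕ x) y)))
    (∑-* (allFin n) ⟦ x ∉ₛ? R ⟧ _)

  module G₂ (R : Subset n) = Graph {E = Link₂ P R} (link₂? R) (link₂-swap {P})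
    (λ (_ , y∉ , _) → proj₁ (∉-⊕⁻ y∉))

  graph₃ : Subset n → Graph₃ n
  graph₃ R = record
    { E      = Link₃ P R
    ; E?     = link₃? R
    ; swap₁₂ = λ {_} {_} {z} → link₂-swap {λ S → Link₁ P S z}
    ; swap₂₃ = map₂ (link₂-swap {P})
    ; x≢y    = λ (_ , y∉ , _) → proj₁ (∉-⊕⁻ y∉)
    }

  -- c = t − 1
  bound₁ : ∀ c → (∀ R xs → Unique xs → length xs ≡ suc c → All (Link₁ P R) xs → ⊥) →
           ∑ (subsets n) D ≤ c * ∑ (subsets n) (pos ∘ D)
  bound₁ c free = ≤-trans (∑-mono (subsets n) local) (≤-reflexive (∑-* (subsets n) c (pos ∘ D)))
    where
    D≤c : ∀ S → D S ≤ c
    D≤c S = ≮⇒≥ λ c<D →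
      let N = filter (link₁? P? S) (allFin n)
      in free S (take (suc c) N)
           (take⁺ (suc c) (filter⁺ (link₁? P? S) (allFin⁺ n)))
           (trans (length-take (suc c) N)
             (m≤n⇒m⊓n≡m (subst (suc c ≤_) (#≡length-filter (link₁? P? S) (allFin n)) c<D)))
           (All-take⁺ (suc c) (all-filter (link₁? P? S) (allFin n)))
    local : ∀ S → D S ≤ c * pos (D S)
    local S with D S | D≤c S
    ... | zero  | _   = z≤n
    ... | suc k | k<c = subst (suc k ≤_) (sym (*-identityʳ c)) k<c

  module _ {k : ℕ} (P⇒∣∣ : ∀ S → P S → ∣ S ∣ ≡ suc k) where

    χ-supported : Supported (suc k) (λ S → ⟦ P? S ⟧)
    χ-supported S 0<χ with P? S
    ... | yes PS = P⇒∣∣ S PS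

    D-supported : Supported k D
    D-supported S 0<D = extend-supported χ-supported S (subst (0 <_) (D≡extend S) 0<D)

    pos-D-supported : Supported k (pos ∘ D)
    pos-D-supported S 0<pos = D-supported S (pos-positive 0<pos)
      where
      pos-positive : ∀ {a} → 0 < pos a → 0 < a
      pos-positive {suc a} _ = s≤s z≤n

    ∑D≡ : ∑ (subsets n) D ≡ suc k * ∑[ S ∈ subsets n ] ⟦ P? S ⟧
    ∑D≡ = trans (∑-cong (subsets n) D≡extend) (∑-extend-supported χ-supported)

  -- In the link graph of `R` a vertex x outside `R` has degree `D (R ⊕ x)`. The bound in the link
  -- thus compares `extend D R` with `extend (pos ∘ D) R`, and summing over `R` allows one
  -- cancellation.
  bound₂ : ∀ c {k} → (∀ S → P S → ∣ S ∣ ≡ suc (suc k)) →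
           (∀ R → let open G₂ R in ∑ V d ≤ c * ∑ V (pos ∘ d)) →
           ∑ (subsets n) D ≤ c * ∑ (subsets n) (pos ∘ D)
  bound₂ c P⇒∣∣ bound = extend-cancel c (D-supported P⇒∣∣) (pos-D-supported P⇒∣∣)
    (≤-trans (∑-mono (subsets n) local) (≤-reflexive (∑-* (subsets n) c _)))
    where
    local : ∀ R → extend D R ≤ c * extend (pos ∘ D) R
    local R = subst₂ _≤_ (∑-cong V d≡) (cong (c *_) (∑-cong V pos-d≡)) (bound R)
      where
      open G₂ R
      d≡ : ∀ x → d x ≡ ⟦ x ∉ₛ? R ⟧ * D (R ⊕ x)
      d≡ = #link₁ (link₁? P?) R
      pos-d≡ : ∀ x → pos (d x) ≡ ⟦ x ∉ₛ? R ⟧ * pos (D (R ⊕ x))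
      pos-d≡ x = trans (cong pos (d≡ x)) (pos-⟦⟧* (x ∉ₛ? R) (D (R ⊕ x)))

  -- A facet of the link is now an ordered pair added to `R`, hence two extensions and two
  -- cancellations.
  bound₃ : ∀ {k} → (∀ S → P S → ∣ S ∣ ≡ suc (suc (suc k))) →
           (∀ R → Graph₃.Bounded (graph₃ R)) →
           ∑ (subsets n) D ≤ 3 * ∑ (subsets n) (pos ∘ D)
  bound₃ P⇒∣∣ bound = extend-cancel 3 (D-supported P⇒∣∣) (pos-D-supported P⇒∣∣)
    (extend-cancel 3 (extend-supported (D-supported P⇒∣∣)) (extend-supported (pos-D-supported P⇒∣∣))
      (≤-trans (∑-mono (subsets n) local) (≤-reflexive (∑-* (subsets n) 3 _))))
    where
    local : ∀ R → extend (extend D) R ≤ 3 * extend (extend (pos ∘ D)) R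
    local R = subst₂ _≤_ (∑-cong (allFin n) ∑d≡) (cong (3 *_) (∑-cong (allFin n) ∑pos-d≡)) (bound R)
      where
      open Graph₃ (graph₃ R) using (d)
      d≡ : ∀ x y → d x y ≡ ⟦ x ∉ₛ? R ⟧ * (⟦ y ∉ₛ? (R ⊕ x) ⟧ * D (R ⊕ x ⊕ y))
      d≡ x y = trans (#link₁ (λ S → link₂? S y) R x)
        (cong (⟦ x ∉ₛ? R ⟧ *_) (#link₁ (link₁? P?) (R ⊕ x) y))
      ∑d≡ : ∀ x → ∑ (allFin n) (d x) ≡ ⟦ x ∉ₛ? R ⟧ * extend D (R ⊕ x)
      ∑d≡ x = trans (∑-cong (allFin n) (d≡ x)) (∑-* (allFin n) ⟦ x ∉ₛ? R ⟧ _)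
      pos-d≡ : ∀ x y → pos (d x y) ≡ ⟦ x ∉ₛ? R ⟧ * (⟦ y ∉ₛ? (R ⊕ x) ⟧ * pos (D (R ⊕ x ⊕ y)))
      pos-d≡ x y = trans (cong pos (d≡ x y)) (trans (pos-⟦⟧* (x ∉ₛ? R) _)
        (cong (⟦ x ∉ₛ? R ⟧ *_) (pos-⟦⟧* (y ∉ₛ? (R ⊕ x)) _)))
      ∑pos-d≡ : ∀ x → ∑ (allFin n) (pos ∘ d x) ≡ ⟦ x ∉ₛ? R ⟧ * extend (pos ∘ D) (R ⊕ x)
      ∑pos-d≡ x = trans (∑-cong (allFin n) (pos-d≡ x)) (∑-* (allFin n) ⟦ x ∉ₛ? R ⟧ _)

-- Embeddings

S⊖x⊕x : ∀ {S : Subset n} {x} → x ∈ₛ S → S ⊖ x ⊕ x ≡ S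
S⊖x⊕x {S = S} {x} x∈S = trans ([]≔-idempotent S x)
  (trans (cong (S [ x ]≔_) (sym ([]=⇒lookup x∈S))) ([]≔-lookup S x))

x∉S⊖x : ∀ (S : Subset n) x → x ∉ₛ S ⊖ x
x∉S⊖x S x x∈ with []=-injective x∈ ([]≔-updates S x)
... | ()

∈-⊖⁻ : ∀ {S : Subset n} {x y} → y ∈ₛ S ⊖ x → y ≢ x × y ∈ₛ S
∈-⊖⁻ {S = S} {x} {y} y∈ with y Fin.≟ x
... | yes refl = contradiction y∈ (x∉S⊖x S x)
... | no y≢x   = y≢x , lookup⇒[]= y S (trans (sym (lookup∘update′ y≢x S outside)) ([]=⇒lookup y∈))

∈-⊖⁺ : ∀ {S : Subset n} {x y} → y ≢ x → y ∈ₛ S → y ∈ₛ S ⊖ x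
∈-⊖⁺ {S = S} {x} {y} y≢x y∈S = []≔-minimal S y x y≢x y∈S

∣S⊖x∣ : ∀ {S : Subset n} {x} → x ∈ₛ S → suc ∣ S ⊖ x ∣ ≡ ∣ S ∣
∣S⊖x∣ {S = S} {x} x∈S = trans (sym (∣S⊕x∣ (x∉S⊖x S x))) (cong ∣_∣ (S⊖x⊕x x∈S))

nonempty : ∀ {S : Subset n} → 0 < ∣ S ∣ → ∃[ x ] x ∈ₛ S
nonempty {S = inside  ∷ S} 0<   = zero , Vec.here
nonempty {S = outside ∷ S} 0<   with nonempty 0<
... | x , x∈ = suc x , Vec.there x∈

empty : ∀ {S : Subset n} {x} → ∣ S ∣ ≡ 0 → x ∉ₛ S
empty {S = outside ∷ S} ∣S∣≡0 (Vec.there x∈) = empty ∣S∣≡0 x∈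

infixl 6 _⊕*_

_⊕*_ : Subset n → List (Fin n) → Subset n
S ⊕* []       = S
S ⊕* (x ∷ xs) = (S ⊕ x) ⊕* xs

∈-⊕*⁻ : ∀ {S : Subset n} xs {y} → y ∈ₛ S ⊕* xs → y ∈ₛ S ⊎ y ∈ xs
∈-⊕*⁻ []       y∈ = inj₁ y∈
∈-⊕*⁻ (x ∷ xs) y∈ with ∈-⊕*⁻ xs y∈
... | inj₂ y∈xs = inj₂ (there y∈xs)
... | inj₁ y∈S⊕x with ∈-⊕⁻ y∈S⊕x
...   | inj₁ y≡x = inj₂ (here y≡x)
...   | inj₂ y∈S = inj₁ y∈S

∈-⊕*⁺ˡ : ∀ {S : Subset n} xs {y} → y ∈ₛ S → y ∈ₛ S ⊕* xs
∈-⊕*⁺ˡ []       y∈S = y∈S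
∈-⊕*⁺ˡ (x ∷ xs) y∈S = ∈-⊕*⁺ˡ xs (∈-⊕⁺ y∈S)

∈-⊕*⁺ʳ : ∀ {S : Subset n} {xs y} → y ∈ xs → y ∈ₛ S ⊕* xs
∈-⊕*⁺ʳ {S = S} {x ∷ xs} (here refl)  = ∈-⊕*⁺ˡ xs (x∈S⊕x S x)
∈-⊕*⁺ʳ                  (there y∈xs) = ∈-⊕*⁺ʳ y∈xs

record Bijection (K : Subset m) (R : Subset n) : Set where
  field
    to        : Fin m → Fin n
    to-∈      : ∀ {x} → x ∈ₛ K → to x ∈ₛ R
    injective : ∀ {x y} → x ∈ₛ K → y ∈ₛ K → to x ≡ to y → x ≡ y
    from      : ∀ {y} → y ∈ₛ R → ∃[ x ] x ∈ₛ K × to x ≡ y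

-- The map `to` must be total, so `default` fills in values outside `K`; injectivity is claimed on
-- `K` only.
bijection : Fin n → (K : Subset m) (R : Subset n) → ∣ K ∣ ≡ ∣ R ∣ → Bijection K R
bijection default [] R ∣K∣≡∣R∣ = record
  { to        = λ ()
  ; to-∈      = λ ()
  ; injective = λ ()
  ; from      = λ y∈R → contradiction y∈R (empty (sym ∣K∣≡∣R∣))
  }
bijection {n} {suc m} default (outside ∷ K) R ∣K∣≡∣R∣ = record
  { to        = λ { zero → default ; (suc x) → B.to x }
  ; to-∈      = λ { (Vec.there x∈) → B.to-∈ x∈ }
  ; injective = λ { (Vec.there x∈) (Vec.there y∈) eq → cong suc (B.injective x∈ y∈ eq) }
  ; from      = λ y∈ → let x , x∈ , eq = B.from y∈ in suc x , Vec.there x∈ , eq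
  }
  where
  module B = Bijection (bijection default K R ∣K∣≡∣R∣)
bijection {n} {suc m} default (inside ∷ K) R ∣K∣≡∣R∣
  with y₀ , y₀∈ ← nonempty {S = R} (subst (0 <_) ∣K∣≡∣R∣ (s≤s z≤n)) = record
  { to        = to
  ; to-∈      = λ { Vec.here → y₀∈ ; (Vec.there x∈) → proj₂ (∈-⊖⁻ (B.to-∈ x∈)) }
  ; injective = injective
  ; from      = from
  }
  where
  module B = Bijection (bijection default K (R ⊖ y₀) (suc-injective (trans ∣K∣≡∣R∣ (sym (∣S⊖x∣ y₀∈)))))
  to : Fin (suc m) → Fin n
  to zero    = y₀
  to (suc x) = B.to x
  injective : ∀ {x y} → x ∈ₛ inside ∷ K → y ∈ₛ inside ∷ K → to x ≡ to y → x ≡ y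
  injective Vec.here       Vec.here       eq = refl
  injective Vec.here       (Vec.there y∈) eq = contradiction (sym eq) (proj₁ (∈-⊖⁻ (B.to-∈ y∈)))
  injective (Vec.there x∈) Vec.here       eq = contradiction eq (proj₁ (∈-⊖⁻ (B.to-∈ x∈)))
  injective (Vec.there x∈) (Vec.there y∈) eq = cong suc (B.injective x∈ y∈ eq)
  from : ∀ {y} → y ∈ₛ R → ∃[ x ] x ∈ₛ inside ∷ K × to x ≡ y
  from {y} y∈R with y Fin.≟ y₀
  ... | yes refl = zero , Vec.here , refl
  ... | no y≢y₀  = let x , x∈ , eq = B.from (∈-⊖⁺ y≢y₀ y∈R) in suc x , Vec.there x∈ , eq

-- `ls` lists the edges of a small `j`-graph on `labels`. `shape` is an inclusion: an embedding
-- takes every listed set to an edge, and so in particular every member of `es`.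
record Cone (r : ℕ) (es : List (Subset m)) (j : ℕ) (labels : List (Fin m)) (ls : List (List (Fin m))) :
       Set where
  field
    apex     : Subset m
    distinct : Unique labels
    outer    : All (_∉ₛ apex) labels
    size     : j + ∣ apex ∣ ≡ r
    shape    : All (_∈ map (apex ⊕*_) ls) es

override : List (Fin m × Fin n) → (Fin m → Fin n) → Fin m → Fin n
override []             f v = f v
override ((a , b) ∷ ps) f v with v Fin.≟ a
... | yes _ = b
... | no  _ = override ps f v

override-∈ : ∀ {ps : List (Fin m × Fin n)} {f a b} → Unique (map proj₁ ps) → (a , b) ∈ ps →
             override ps f a ≡ b
override-∈ {ps = (a′ , b′) ∷ ps} {a = a} (_ ∷ _)   (here refl) with a Fin.≟ a
... | yes _  = refl
... | no a≢a = contradiction refl a≢a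
override-∈ {ps = (a′ , b′) ∷ ps} {a = a} (a′∉ ∷ u) (there ab∈) with a Fin.≟ a′
... | yes refl = contradiction refl (All.lookup a′∉ (∈-map⁺ proj₁ ab∈))
... | no _     = override-∈ u ab∈

override-∉ : ∀ {ps : List (Fin m × Fin n)} {f v} → v ∉ map proj₁ ps → override ps f v ≡ f v
override-∉ {ps = []}             v∉ = refl
override-∉ {ps = (a , b) ∷ ps} {v = v} v∉ with v Fin.≟ a
... | yes v≡a = contradiction (here v≡a) v∉
... | no _    = override-∉ (v∉ ∘ there)

unique-proj₂ : ∀ {ps : List (Fin m × Fin n)} {a a′ b} → Unique (map proj₂ ps) →
               (a , b) ∈ ps → (a′ , b) ∈ ps → a ≡ a′
unique-proj₂ _        (here refl) (here refl) = refl
unique-proj₂ (b∉ ∷ _) (here refl) (there ∈ps) = contradiction refl (All.lookup b∉ (∈-map⁺ proj₂ ∈ps))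
unique-proj₂ (b∉ ∷ _) (there ∈ps) (here refl) = contradiction refl (All.lookup b∉ (∈-map⁺ proj₂ ∈ps))
unique-proj₂ (_ ∷ u)  (there ∈ps) (there ∈ps′) = unique-proj₂ u ∈ps ∈ps′

module _ (T : RGraph m r) (covered : ∀ v → Any (v ∈ₛ_) (edges T)) (G : RGraph n r) where

  -- The apex goes bijectively onto `R`, the labels follow `ps`; in `qss` the first components spell
  -- the edges of the small tree and the second their images in the link of `R`. The map is
  -- injective on all of `Fin m` because every vertex of `T` lies in an edge, hence in the apex or
  -- among the labels.
  contains : (ps : List (Fin m × Fin n)) (qss : List (List (Fin m × Fin n))) → All (All (_∈ ps)) qss →
    ∀ {j} → Cone r (edges T) j (map proj₁ ps) (map (map proj₁) qss) →
    Fin n → (R : Subset n) → j + ∣ R ∣ ≡ r → Unique (map proj₂ ps) → All (_∉ₛ R) (map proj₂ ps) →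
    All (λ qs → R ⊕* map proj₂ qs ∈ edges G) qss → Contains G T
  contains ps qss qss⊆ps {j} cone default R ∣R∣ distinct′ outer′ edges′ =
    f , f-injective _ _ , All.tabulate λ {e} e∈ → image∈ (All.lookup shape e∈)
    where
    open Cone cone
    open Bijection (bijection default apex R (+-cancelˡ-≡ j ∣ apex ∣ ∣ R ∣ (trans size (sym ∣R∣))))
    open DecMembership (Fin._≟_ {m}) using (_∈?_)
    f : Fin m → Fin n
    f = override ps to
    f-∈ : ∀ {a b} → (a , b) ∈ ps → f a ≡ b
    f-∈ = override-∈ distinct
    f-apex : ∀ {v} → v ∈ₛ apex → f v ≡ to v
    f-apex v∈ = override-∉ {ps = ps} (λ v∈ps → All.lookup outer v∈ps v∈)

    apex-or-label : ∀ v → v ∈ₛ apex ⊎ ∃[ b ] (v , b) ∈ ps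
    apex-or-label v with e , e∈ , v∈e ← find (covered v)
      with l , l∈ , refl ← ∈-map⁻ (apex ⊕*_) (All.lookup shape e∈)
      with qs , qs∈ , refl ← ∈-map⁻ (map proj₁) l∈
      with ∈-⊕*⁻ (map proj₁ qs) v∈e
    ... | inj₁ v∈ = inj₁ v∈
    ... | inj₂ v∈ with (_ , b) , ab∈ , refl ← ∈-map⁻ proj₁ v∈ =
      inj₂ (b , All.lookup (All.lookup qss⊆ps qs∈) ab∈)

    f-injective : ∀ v w → f v ≡ f w → v ≡ w
    f-injective v w fv≡fw with apex-or-label v | apex-or-label w
    ... | inj₁ v∈ | inj₁ w∈ =
      injective v∈ w∈ (trans (sym (f-apex v∈)) (trans fv≡fw (f-apex w∈)))
    ... | inj₁ v∈ | inj₂ (b , wb∈) = contradiction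
      (subst (_∈ₛ R) (trans (sym (f-apex v∈)) (trans fv≡fw (f-∈ wb∈))) (to-∈ v∈))
      (All.lookup outer′ (∈-map⁺ proj₂ wb∈))
    ... | inj₂ (b , vb∈) | inj₁ w∈ = contradiction
      (subst (_∈ₛ R) (trans (sym (f-apex w∈)) (trans (sym fv≡fw) (f-∈ vb∈))) (to-∈ w∈))
      (All.lookup outer′ (∈-map⁺ proj₂ vb∈))
    ... | inj₂ (b , vb∈) | inj₂ (b′ , wb′∈) with refl ← trans (sym (f-∈ vb∈)) (trans fv≡fw (f-∈ wb′∈)) =
      unique-proj₂ distinct′ vb∈ wb′∈

    image∈ : ∀ {e} → e ∈ map (apex ⊕*_) (map (map proj₁) qss) → image f e ∈ edges G
    image∈ e∈ with l , l∈ , refl ← ∈-map⁻ (apex ⊕*_) e∈ with qs , qs∈ , refl ← ∈-map⁻ (map proj₁) l∈ =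
      subst (_∈ edges G) (sym (⊆-antisym image⊆ image⊇)) (All.lookup edges′ qs∈)
      where
      qs⊆ps : ∀ {p} → p ∈ qs → p ∈ ps
      qs⊆ps = All.lookup (All.lookup qss⊆ps qs∈)
      image⊆ : ∀ {y} → y ∈ₛ image f (apex ⊕* map proj₁ qs) → y ∈ₛ R ⊕* map proj₂ qs
      image⊆ {y} y∈ with x , x∈ , refl ← Equivalence.to (∈-image f _ y) y∈ with ∈-⊕*⁻ (map proj₁ qs) x∈
      ... | inj₁ x∈apex = ∈-⊕*⁺ˡ (map proj₂ qs) (subst (_∈ₛ R) (sym (f-apex x∈apex)) (to-∈ x∈apex))
      ... | inj₂ x∈qs with (_ , b) , xb∈ , refl ← ∈-map⁻ proj₁ x∈qs =
        subst (_∈ₛ R ⊕* map proj₂ qs) (sym (f-∈ (qs⊆ps xb∈))) (∈-⊕*⁺ʳ (∈-map⁺ proj₂ xb∈))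
      image⊇ : ∀ {y} → y ∈ₛ R ⊕* map proj₂ qs → y ∈ₛ image f (apex ⊕* map proj₁ qs)
      image⊇ {y} y∈ with ∈-⊕*⁻ (map proj₂ qs) y∈
      ... | inj₁ y∈R with x , x∈ , refl ← from y∈R =
        Equivalence.from (∈-image f _ y) (x , ∈-⊕*⁺ˡ (map proj₁ qs) x∈ , f-apex x∈)
      ... | inj₂ y∈qs with (a , _) , ay∈ , refl ← ∈-map⁻ proj₂ y∈qs =
        Equivalence.from (∈-image f _ y) (a , ∈-⊕*⁺ʳ (∈-map⁺ proj₁ ay∈) , f-∈ (qs⊆ps ay∈))

-- The shapes of tight trees and the bound for each

data Shape {m : ℕ} (r : ℕ) (es : List (Subset m)) : ℕ → Set where
  singles   : ∀ {x xs} → Cone r es 1 (x ∷ xs) (map (_∷ []) (x ∷ xs)) → Shape r es (suc (length xs))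
  path₃     : ∀ {p b a q} → Cone r es 2 (p ∷ b ∷ a ∷ q ∷ [])
                ((p ∷ b ∷ []) ∷ (b ∷ a ∷ []) ∷ (a ∷ q ∷ []) ∷ []) → Shape r es 3
  fork      : ∀ {p b a q w} → Cone r es 2 (p ∷ b ∷ a ∷ q ∷ w ∷ [])
                ((p ∷ b ∷ []) ∷ (b ∷ a ∷ []) ∷ (a ∷ q ∷ []) ∷ (a ∷ w ∷ []) ∷ []) → Shape r es 4
  path₄     : ∀ {p u x v q} → Cone r es 2 (p ∷ u ∷ x ∷ v ∷ q ∷ [])
                ((p ∷ u ∷ []) ∷ (u ∷ x ∷ []) ∷ (x ∷ v ∷ []) ∷ (v ∷ q ∷ []) ∷ []) → Shape r es 4
  star      : ∀ {a b c p q w} → Cone r es 3 (a ∷ b ∷ c ∷ p ∷ q ∷ w ∷ [])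
                ((a ∷ b ∷ c ∷ []) ∷ (b ∷ c ∷ p ∷ []) ∷ (a ∷ c ∷ q ∷ []) ∷ (a ∷ b ∷ w ∷ []) ∷ []) →
              Shape r es 4
  tightPath : ∀ {p u y x v q} → Cone r es 3 (p ∷ u ∷ y ∷ x ∷ v ∷ q ∷ [])
                ((p ∷ u ∷ y ∷ []) ∷ (u ∷ y ∷ x ∷ []) ∷ (y ∷ x ∷ v ∷ []) ∷ (x ∷ v ∷ q ∷ []) ∷ []) →
              Shape r es 4

map-proj₁-zip : (xs : List A) (ys : List B) → length xs ≡ length ys → map proj₁ (zip xs ys) ≡ xs
map-proj₁-zip []       []       eq = refl
map-proj₁-zip (x ∷ xs) (y ∷ ys) eq = cong (x ∷_) (map-proj₁-zip xs ys (suc-injective eq))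

map-proj₂-zip : (xs : List A) (ys : List B) → length xs ≡ length ys → map proj₂ (zip xs ys) ≡ ys
map-proj₂-zip []       []       eq = refl
map-proj₂-zip (x ∷ xs) (y ∷ ys) eq = cong (y ∷_) (map-proj₂-zip xs ys (suc-injective eq))

module _ (G : RGraph n r) where

  open DecMembership (≡-decᵥ {n = n} _≟ᵇ_) using (_∈?_)
  open Link {P = _∈ edges G} (λ S → S ∈? edges G)

  Edge : Subset n → Set
  Edge = _∈ edges G

  uniform-∈ : ∀ {S} → Edge S → ∣ S ∣ ≡ r
  uniform-∈ = All.lookup (uniform G)

  link₁-size : ∀ {R x} → Link₁ Edge R x → 1 + ∣ R ∣ ≡ r
  link₁-size (x∉ , e∈) = trans (sym (∣S⊕x∣ x∉)) (uniform-∈ e∈)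

  link₂-size : ∀ {R x y} → Link₂ Edge R x y → 2 + ∣ R ∣ ≡ r
  link₂-size (x∉ , e) = trans (cong suc (sym (∣S⊕x∣ x∉))) (link₁-size e)

  link₃-size : ∀ {R x y z} → Link₃ Edge R x y z → 3 + ∣ R ∣ ≡ r
  link₃-size (x∉ , e) = trans (cong (2 +_) (sym (∣S⊕x∣ x∉))) (link₂-size e)

  module _ (T : RGraph m r) (covered : ∀ v → Any (v ∈ₛ_) (edges T)) (¬contains : ¬ Contains G T) where

    shape-bound : ∀ {t} → Shape r (edges T) t →
                  ∑ (subsets n) D ≤ (t ∸ 1) * ∑ (subsets n) (pos ∘ D)
    shape-bound (singles {x} {xs′} cone) = bound₁ (length xs′) free
      where
      xs : List (Fin m)
      xs = x ∷ xs′
      free : ∀ R ys → Unique ys → length ys ≡ length xs → All (Link₁ Edge R) ys → ⊥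
      -- `len` excludes the empty list; the first vertex `y` serves as default value, and its link
      -- membership gives the size of `R`.
      free R ys@(y ∷ _) un len links = ¬contains (contains T covered G ps (map (_∷ []) ps)
        (All-map⁺ (All.tabulate (λ p∈ → p∈ ∷ [])))
        (subst₂ (Cone r (edges T) 1) (sym (map-proj₁-zip xs ys (sym len))) ls≡ cone)
        y R (link₁-size (All.head links))
        (subst Unique (sym ys≡) un)
        (subst (All (_∉ₛ R)) (sym ys≡) (All.map proj₁ links))
        (All-map⁺ (All-map⁻ (subst (All (λ y → Edge (R ⊕ y))) (sym ys≡) (All.map proj₂ links)))))
        where
        ps : List (Fin m × Fin n)
        ps = zip xs ys
        ys≡ : map proj₂ ps ≡ ys
        ys≡ = map-proj₂-zip xs ys (sym len)
        ls≡ : map (_∷ []) xs ≡ map (map proj₁) (map (_∷ []) ps)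
        ls≡ = trans (cong (map (_∷ [])) (sym (map-proj₁-zip xs ys (sym len))))
                (trans (sym (map-∘ ps)) (map-∘ ps))
    shape-bound (path₃ {p} {b} {a} {q} cone) =
      -- `Cone.size` writes r as `2 + ∣ apex ∣`, the form that `bound₂` asks for.
      bound₂ 2 (λ S S∈ → trans (uniform-∈ S∈) (sym (Cone.size cone))) λ R →
        G₂.path₃-free R λ {p′} {b′} {a′} {q′} un pb ba aq → ¬contains (contains T covered G
          ((p , p′) ∷ (b , b′) ∷ (a , a′) ∷ (q , q′) ∷ [])
          ( ((p , p′) ∷ (b , b′) ∷ []) ∷ ((b , b′) ∷ (a , a′) ∷ []) ∷ ((a , a′) ∷ (q , q′) ∷ []) ∷ [])
          ((1st ∷ 2nd ∷ []) ∷ (2nd ∷ 3rd ∷ []) ∷ (3rd ∷ 4th ∷ []) ∷ [])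
          cone p′ R (link₂-size pb) un
          (proj₁ pb ∷ proj₁ ba ∷ proj₁ aq ∷ proj₁ (link₂-swap {Edge} aq) ∷ [])
          (proj₂ (proj₂ pb) ∷ proj₂ (proj₂ ba) ∷ proj₂ (proj₂ aq) ∷ []))
    shape-bound (fork {p} {b} {a} {q} {w} cone) =
      bound₂ 3 (λ S S∈ → trans (uniform-∈ S∈) (sym (Cone.size cone))) λ R →
        G₂.fork-free R λ {p′} {b′} {a′} {q′} {w′} un pb ba aq aw → ¬contains (contains T covered G
          ((p , p′) ∷ (b , b′) ∷ (a , a′) ∷ (q , q′) ∷ (w , w′) ∷ [])
          ( ((p , p′) ∷ (b , b′) ∷ []) ∷ ((b , b′) ∷ (a , a′) ∷ []) ∷ ((a , a′) ∷ (q , q′) ∷ [])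
          ∷ ((a , a′) ∷ (w , w′) ∷ []) ∷ [])
          ((1st ∷ 2nd ∷ []) ∷ (2nd ∷ 3rd ∷ []) ∷ (3rd ∷ 4th ∷ []) ∷ (3rd ∷ 5th ∷ []) ∷ [])
          cone p′ R (link₂-size pb) un
          (proj₁ pb ∷ proj₁ ba ∷ proj₁ aq ∷ proj₁ (link₂-swap {Edge} aq) ∷ proj₁ (link₂-swap {Edge} aw) ∷ [])
          (proj₂ (proj₂ pb) ∷ proj₂ (proj₂ ba) ∷ proj₂ (proj₂ aq) ∷ proj₂ (proj₂ aw) ∷ []))
    shape-bound (path₄ {p} {u} {x} {v} {q} cone) =
      bound₂ 3 (λ S S∈ → trans (uniform-∈ S∈) (sym (Cone.size cone))) λ R →
        G₂.path₄-free R λ {p′} {u′} {x′} {v′} {q′} un pu ux xv vq → ¬contains (contains T covered G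
          ((p , p′) ∷ (u , u′) ∷ (x , x′) ∷ (v , v′) ∷ (q , q′) ∷ [])
          ( ((p , p′) ∷ (u , u′) ∷ []) ∷ ((u , u′) ∷ (x , x′) ∷ []) ∷ ((x , x′) ∷ (v , v′) ∷ [])
          ∷ ((v , v′) ∷ (q , q′) ∷ []) ∷ [])
          ((1st ∷ 2nd ∷ []) ∷ (2nd ∷ 3rd ∷ []) ∷ (3rd ∷ 4th ∷ []) ∷ (4th ∷ 5th ∷ []) ∷ [])
          cone p′ R (link₂-size pu) un
          (proj₁ pu ∷ proj₁ ux ∷ proj₁ xv ∷ proj₁ vq ∷ proj₁ (link₂-swap {Edge} vq) ∷ [])
          (proj₂ (proj₂ pu) ∷ proj₂ (proj₂ ux) ∷ proj₂ (proj₂ xv) ∷ proj₂ (proj₂ vq) ∷ []))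
    shape-bound (star {a} {b} {c} {p} {q} {w} cone) =
      bound₃ (λ S S∈ → trans (uniform-∈ S∈) (sym (Cone.size cone))) λ R →
        let open Graph₃ (graph₃ R) in
        star-free (graph₃ R) λ {a′} {b′} {c′} {p′} {q′} {w′} un abc bcp acq abw → ¬contains (contains T covered G
          ((a , a′) ∷ (b , b′) ∷ (c , c′) ∷ (p , p′) ∷ (q , q′) ∷ (w , w′) ∷ [])
          ( ((a , a′) ∷ (b , b′) ∷ (c , c′) ∷ []) ∷ ((b , b′) ∷ (c , c′) ∷ (p , p′) ∷ [])
          ∷ ((a , a′) ∷ (c , c′) ∷ (q , q′) ∷ []) ∷ ((a , a′) ∷ (b , b′) ∷ (w , w′) ∷ []) ∷ [])
          ( (1st ∷ 2nd ∷ 3rd ∷ []) ∷ (2nd ∷ 3rd ∷ 4th ∷ []) ∷ (1st ∷ 3rd ∷ 5th ∷ [])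
          ∷ (1st ∷ 2nd ∷ 6th ∷ []) ∷ [])
          cone a′ R (link₃-size abc) un
          ( proj₁ abc ∷ proj₁ bcp ∷ proj₁ (swap₁₂ bcp) ∷ proj₁ (swap₁₂ (swap₂₃ bcp))
          ∷ proj₁ (swap₁₂ (swap₂₃ acq)) ∷ proj₁ (swap₁₂ (swap₂₃ abw)) ∷ [])
          ( proj₂ (proj₂ (proj₂ abc)) ∷ proj₂ (proj₂ (proj₂ bcp)) ∷ proj₂ (proj₂ (proj₂ acq))
          ∷ proj₂ (proj₂ (proj₂ abw)) ∷ []))
    shape-bound (tightPath {p} {u} {y} {x} {v} {q} cone) =
      bound₃ (λ S S∈ → trans (uniform-∈ S∈) (sym (Cone.size cone))) λ R →
        let open Graph₃ (graph₃ R) in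
        tight-path-free (graph₃ R) λ {p′} {u′} {y′} {x′} {v′} {q′} un puy uyx yxv xvq →
          ¬contains (contains T covered G
          ((p , p′) ∷ (u , u′) ∷ (y , y′) ∷ (x , x′) ∷ (v , v′) ∷ (q , q′) ∷ [])
          ( ((p , p′) ∷ (u , u′) ∷ (y , y′) ∷ []) ∷ ((u , u′) ∷ (y , y′) ∷ (x , x′) ∷ [])
          ∷ ((y , y′) ∷ (x , x′) ∷ (v , v′) ∷ []) ∷ ((x , x′) ∷ (v , v′) ∷ (q , q′) ∷ []) ∷ [])
          ( (1st ∷ 2nd ∷ 3rd ∷ []) ∷ (2nd ∷ 3rd ∷ 4th ∷ []) ∷ (3rd ∷ 4th ∷ 5th ∷ [])
          ∷ (4th ∷ 5th ∷ 6th ∷ []) ∷ [])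
          cone p′ R (link₃-size puy) un
          ( proj₁ puy ∷ proj₁ uyx ∷ proj₁ yxv ∷ proj₁ xvq ∷ proj₁ (swap₁₂ xvq)
          ∷ proj₁ (swap₁₂ (swap₂₃ xvq)) ∷ [])
          ( proj₂ (proj₂ (proj₂ puy)) ∷ proj₂ (proj₂ (proj₂ uyx)) ∷ proj₂ (proj₂ (proj₂ yxv))
          ∷ proj₂ (proj₂ (proj₂ xvq)) ∷ []))

  edges≤ : 2 ≤ r → ∀ k → ∑ (subsets n) D ≤ k * ∑ (subsets n) (pos ∘ D) → r * e[ G ] ≤ k * length (∂ G)
  edges≤ 2≤r k bound = begin
    r * e[ G ]                               ≤⟨ *-monoʳ-≤ r (#-≥ (_∈? edges G) (unique G) subsets-complete (All.tabulate id)) ⟩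
    r * # (_∈? edges G) (subsets n)          ≡⟨ cong (_* # (_∈? edges G) (subsets n)) r≡ ⟨
    suc (pred r) * # (_∈? edges G) (subsets n) ≡⟨ ∑D≡ (λ S S∈ → trans (uniform-∈ S∈) (sym r≡)) ⟨
    ∑ (subsets n) D                          ≤⟨ bound ⟩
    k * ∑ (subsets n) (pos ∘ D)              ≤⟨ *-monoʳ-≤ k (∑-mono (subsets n) pos-D≤) ⟩
    k * # (inShadow? G) (subsets n)          ≡⟨ cong (k *_) (#≡length-filter (inShadow? G) (subsets n)) ⟩
    k * length (∂ G)                         ∎
    where
    open ≤-Reasoning
    r≡ : suc (pred r) ≡ r
    r≡ = suc-pred r {{>-nonZero (<⇒≤ 2≤r)}}
    -- A set of positive degree lies in some edge `S ⊕ x` and has one vertex less, so it belongs to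
    -- the shadow.
    pos-D≤ : ∀ S → pos (D S) ≤ ⟦ inShadow? G S ⟧
    pos-D≤ S with 0 <? D S
    ... | no 0≮D = subst (λ k → pos k ≤ ⟦ inShadow? G S ⟧) (sym (n≤0⇒n≡0 (≮⇒≥ 0≮D))) z≤n
    ... | yes 0<D =
      let x , x∉S , e∈ = witness (∑-positive (allFin n) _ 0<D)
      in ≤-reflexive (trans (0<⇒pos≡1 0<D) (sym (⟦⟧-yes (inShadow? G S)
           ( cong (_∸ 1) (link₁-size (x∉S , e∈)) , lose e∈ ∈-⊕⁺))))
      where
      witness : ∃[ x ] 0 < ⟦ link₁? (_∈? edges G) S x ⟧ → ∃[ x ] Link₁ Edge S x
      witness (x , 0<) with link₁? (_∈? edges G) S x
      ... | yes l = x , l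

-- Classification of tight trees

⊕*-⊕ : ∀ (S : Subset n) xs x → (S ⊕* xs) ⊕ x ≡ (S ⊕ x) ⊕* xs
⊕*-⊕ S []       x = refl
⊕*-⊕ S (y ∷ xs) x = trans (⊕*-⊕ (S ⊕ y) xs x) (cong (_⊕* xs) (⊕-comm S y x))

⊕*-↭ : ∀ {S : Subset n} {xs ys} → xs ↭ ys → S ⊕* xs ≡ S ⊕* ys
⊕*-↭ ↭.refl                 = refl
⊕*-↭ (↭.prep x xs↭ys)       = ⊕*-↭ xs↭ys
⊕*-↭ {S = S} {_ ∷ _ ∷ xs} (↭.swap x y xs↭ys) = trans (cong (_⊕* xs) (⊕-comm S x y)) (⊕*-↭ xs↭ys)
⊕*-↭ (↭.trans xs↭ys ys↭zs)  = trans (⊕*-↭ xs↭ys) (⊕*-↭ ys↭zs)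

S⊕x⊖x : ∀ {S : Subset n} {x} → x ∉ₛ S → S ⊕ x ⊖ x ≡ S
S⊕x⊖x {S = inside  ∷ S} {zero}  x∉ = contradiction Vec.here x∉
S⊕x⊖x {S = outside ∷ S} {zero}  x∉ = refl
S⊕x⊖x {S = b ∷ S}       {suc x} x∉ = cong (b ∷_) (S⊕x⊖x (x∉ ∘ Vec.there))

replace : ∀ {K : Subset n} {a v} xs → a ∉ₛ K → a ∉ xs → K ⊕* (a ∷ xs) ⊖ a ⊕ v ≡ K ⊕* (v ∷ xs)
replace {K = K} {a} {v} xs a∉K a∉xs = begin
  K ⊕* (a ∷ xs) ⊖ a ⊕ v ≡⟨ cong (λ S → S ⊖ a ⊕ v) (⊕*-⊕ K xs a) ⟨
  (K ⊕* xs) ⊕ a ⊖ a ⊕ v ≡⟨ cong (_⊕ v) (S⊕x⊖x (λ a∈ → [ a∉K , a∉xs ]′ (∈-⊕*⁻ xs a∈))) ⟩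
  (K ⊕* xs) ⊕ v         ≡⟨ ⊕*-⊕ K xs v ⟩
  K ⊕* (v ∷ xs)         ∎
  where open ≡-Reasoning

-- Over a fixed core an exchange only alters the list of named vertices. The two permutations bring
-- `a` to the front and put the result into the order that `Shape` prescribes.
exchange : ∀ {e K : Subset n} {xs ys zs a v} → e ≡ K ⊕* xs → xs ↭ a ∷ ys → a ∉ₛ K → a ∉ ys →
           v ∷ ys ↭ zs → e ⊖ a ⊕ v ≡ K ⊕* zs
exchange {ys = ys} {a = a} {v} e≡ xs↭ a∉K a∉ys ↭zs =
  trans (cong (λ S → S ⊖ a ⊕ v) (trans e≡ (⊕*-↭ xs↭))) (trans (replace ys a∉K a∉ys) (⊕*-↭ ↭zs))

-- Taking out the vertices that the exchanges remove leaves `core`, the future apex.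
record Carved (e : Subset n) (xs : List (Fin n)) : Set where
  field
    core    : Subset n
    carved  : e ≡ core ⊕* xs
    removed : All (_∉ₛ core) xs
    inner   : ∀ {x} → x ∈ₛ core → x ∈ₛ e
    size    : length xs + ∣ core ∣ ≡ ∣ e ∣

carve : ∀ {xs} → Unique xs → {e : Subset n} → All (_∈ₛ e) xs → Carved e xs
carve {xs = []}     []        {e} []          = record
  { core = e ; carved = refl ; removed = [] ; inner = id ; size = refl }
carve {xs = x ∷ xs} (x∉ ∷ un) {e} (x∈e ∷ xs∈e) = record
  { core    = core
  ; carved  = trans (sym (S⊖x⊕x x∈e)) (trans (cong (_⊕ x) carved) (⊕*-⊕ core xs x))
  ; removed = x∉S⊖x e x ∘ inner ∷ removed
  ; inner   = proj₂ ∘ ∈-⊖⁻ ∘ inner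
  ; size    = trans (cong suc size) (∣S⊖x∣ x∈e)
  }
  where
  open Carved (carve un {e ⊖ x}
    (All.tabulate λ y∈ → ∈-⊖⁺ (≢-sym (All.lookup x∉ y∈)) (All.lookup xs∈e y∈)))

∈∉⇒≢ : ∀ {S : Subset n} {x y} → x ∈ₛ S → y ∉ₛ S → x ≢ y
∈∉⇒≢ x∈ y∉ refl = y∉ x∈

≢⇒∉₁ : {x y : A} → x ≢ y → x ∉ y ∷ []
≢⇒∉₁ x≢y (here x≡y) = x≢y x≡y

≢⇒∉₂ : {x y z : A} → x ≢ y → x ≢ z → x ∉ y ∷ z ∷ []
≢⇒∉₂ x≢y x≢z (here x≡y)         = x≢y x≡y
≢⇒∉₂ x≢y x≢z (there (here x≡z)) = x≢z x≡z

relocate : {xs ys zs : List A} → All (_∈ zs) ys → All (_∈ ys) xs → All (_∈ zs) xs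
relocate ys⊆zs = All.map (All.lookup ys⊆zs)

swap₂ : {x y : A} → x ∷ y ∷ [] ↭ y ∷ x ∷ []
swap₂ = ↭.swap _ _ ↭.refl

module _ {m r : ℕ} {es : List (Subset m)} where

  -- If a = b, the edges are a, p, q over e without a. Otherwise they are bp, ab, aq over e without
  -- a, b, which is the path p b a q.
  star₂-shape : ∀ {e a p b q} → ∣ e ∣ ≡ r → a ∈ₛ e → b ∈ₛ e → p ∉ₛ e → q ∉ₛ e → p ≢ q →
    All (_∈ e ∷ e ⊖ a ⊕ p ∷ e ⊖ b ⊕ q ∷ []) es → Shape r es 3
  star₂-shape {e} {a} {p} {b} {q} ∣e∣≡r a∈ b∈ p∉ q∉ p≢q es⊆ with a Fin.≟ b
  ... | yes refl = singles {x = a} {p ∷ q ∷ []} record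
    { apex     = e ⊖ a
    ; distinct = (∈∉⇒≢ a∈ p∉ ∷ ∈∉⇒≢ a∈ q∉ ∷ []) ∷ (p≢q ∷ []) ∷ [] ∷ []
    ; outer    = x∉S⊖x e a ∷ p∉ ∘ proj₂ ∘ ∈-⊖⁻ ∷ q∉ ∘ proj₂ ∘ ∈-⊖⁻ ∷ []
    ; size     = trans (∣S⊖x∣ a∈) ∣e∣≡r
    ; shape    = relocate (here (sym (S⊖x⊕x a∈)) ∷ 2nd ∷ 3rd ∷ []) es⊆
    }
  ... | no a≢b = path₃ {p = p} {b} {a} {q} record
    { apex     = core
    ; distinct = (≢-sym (∈∉⇒≢ b∈ p∉) ∷ ≢-sym (∈∉⇒≢ a∈ p∉) ∷ p≢q ∷ [])
                 ∷ (≢-sym a≢b ∷ ∈∉⇒≢ b∈ q∉ ∷ []) ∷ (∈∉⇒≢ a∈ q∉ ∷ []) ∷ [] ∷ []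
    ; outer    = p∉ ∘ inner ∷ All.lookup removed 2nd ∷ All.lookup removed 1st ∷ q∉ ∘ inner ∷ []
    ; size     = trans size ∣e∣≡r
    ; shape    = relocate
        ( there (here (trans carved (⊕*-↭ swap₂)))
        ∷ here (exchange carved ↭.refl (All.lookup removed 1st) (≢⇒∉₁ a≢b) ↭.refl)
        ∷ there (there (here (exchange carved swap₂ (All.lookup removed 2nd) (≢⇒∉₁ (≢-sym a≢b)) swap₂)))
        ∷ []) es⊆
    }
    where open Carved (carve {xs = a ∷ b ∷ []} ((a≢b ∷ []) ∷ [] ∷ []) (a∈ ∷ b∈ ∷ []))

  -- Over e without x, y the edges become xy, yp₁, yp₂, xq. The branching vertex is y, which
  -- survives both exchanges of x.
  fork-shape : ∀ {e x p₁ p₂ y q} → ∣ e ∣ ≡ r → x ∈ₛ e → y ∈ₛ e → x ≢ y →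
    p₁ ∉ₛ e → p₂ ∉ₛ e → q ∉ₛ e → p₁ ≢ p₂ → p₁ ≢ q → p₂ ≢ q →
    All (_∈ e ∷ e ⊖ x ⊕ p₁ ∷ e ⊖ x ⊕ p₂ ∷ e ⊖ y ⊕ q ∷ []) es → Shape r es 4
  fork-shape {e} {x} {p₁} {p₂} {y} {q} ∣e∣≡r x∈ y∈ x≢y p₁∉ p₂∉ q∉ p₁≢p₂ p₁≢q p₂≢q es⊆ =
    fork {p = q} {x} {y} {p₁} {p₂} record
    { apex     = core
    ; distinct = (≢-sym (∈∉⇒≢ x∈ q∉) ∷ ≢-sym (∈∉⇒≢ y∈ q∉) ∷ ≢-sym p₁≢q ∷ ≢-sym p₂≢q ∷ [])
                 ∷ (x≢y ∷ ∈∉⇒≢ x∈ p₁∉ ∷ ∈∉⇒≢ x∈ p₂∉ ∷ []) ∷ (∈∉⇒≢ y∈ p₁∉ ∷ ∈∉⇒≢ y∈ p₂∉ ∷ [])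
                 ∷ (p₁≢p₂ ∷ []) ∷ [] ∷ []
    ; outer    = q∉ ∘ inner ∷ x∉core ∷ y∉core ∷ p₁∉ ∘ inner ∷ p₂∉ ∘ inner ∷ []
    ; size     = trans size ∣e∣≡r
    ; shape    = relocate
        ( there (here carved)
        ∷ there (there (here (exchange carved ↭.refl x∉core (≢⇒∉₁ x≢y) swap₂)))
        ∷ there (there (there (here (exchange carved ↭.refl x∉core (≢⇒∉₁ x≢y) swap₂))))
        ∷ here (exchange carved swap₂ y∉core (≢⇒∉₁ (≢-sym x≢y)) ↭.refl)
        ∷ []) es⊆
    }
    where
    open Carved (carve {xs = x ∷ y ∷ []} ((x≢y ∷ []) ∷ [] ∷ []) (x∈ ∷ y∈ ∷ []))
    x∉core : x ∉ₛ core
    x∉core = All.lookup removed 1st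
    y∉core : y ∉ₛ core
    y∉core = All.lookup removed 2nd

  -- The coincidences among the removed vertices a, b, c decide: all equal gives single vertices,
  -- exactly two equal the fork, all distinct the triple star.
  star₃-shape : ∀ {e a p b q c w} → ∣ e ∣ ≡ r → a ∈ₛ e → b ∈ₛ e → c ∈ₛ e →
    p ∉ₛ e → q ∉ₛ e → w ∉ₛ e → p ≢ q → p ≢ w → q ≢ w →
    All (_∈ e ∷ e ⊖ a ⊕ p ∷ e ⊖ b ⊕ q ∷ e ⊖ c ⊕ w ∷ []) es → Shape r es 4
  star₃-shape {e} {a} {p} {b} {q} {c} {w} ∣e∣≡r a∈ b∈ c∈ p∉ q∉ w∉ p≢q p≢w q≢w es⊆
    with a Fin.≟ b | a Fin.≟ c | b Fin.≟ c
  ... | yes refl | yes refl | _ = singles {x = a} {p ∷ q ∷ w ∷ []} record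
    { apex     = e ⊖ a
    ; distinct = (∈∉⇒≢ a∈ p∉ ∷ ∈∉⇒≢ a∈ q∉ ∷ ∈∉⇒≢ a∈ w∉ ∷ []) ∷ (p≢q ∷ p≢w ∷ []) ∷ (q≢w ∷ []) ∷ [] ∷ []
    ; outer    = x∉S⊖x e a ∷ p∉ ∘ proj₂ ∘ ∈-⊖⁻ ∷ q∉ ∘ proj₂ ∘ ∈-⊖⁻ ∷ w∉ ∘ proj₂ ∘ ∈-⊖⁻ ∷ []
    ; size     = trans (∣S⊖x∣ a∈) ∣e∣≡r
    ; shape    = relocate (here (sym (S⊖x⊕x a∈)) ∷ 2nd ∷ 3rd ∷ 4th ∷ []) es⊆
    }
  ... | yes refl | no a≢c | _ = fork-shape ∣e∣≡r a∈ c∈ a≢c p∉ q∉ w∉ p≢q p≢w q≢w es⊆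
  ... | no a≢b | yes refl | _ = fork-shape ∣e∣≡r a∈ b∈ a≢b p∉ w∉ q∉ p≢w p≢q (≢-sym q≢w)
    (relocate (1st ∷ 2nd ∷ 4th ∷ 3rd ∷ []) es⊆)
  ... | no a≢b | no _ | yes refl = fork-shape ∣e∣≡r b∈ a∈ (≢-sym a≢b) q∉ w∉ p∉ q≢w (≢-sym p≢q) (≢-sym p≢w)
    (relocate (1st ∷ 4th ∷ 2nd ∷ 3rd ∷ []) es⊆)
  ... | no a≢b | no a≢c | no b≢c = star {a = a} {b} {c} {p} {q} {w} record
    { apex     = core
    ; distinct = (a≢b ∷ a≢c ∷ ∈∉⇒≢ a∈ p∉ ∷ ∈∉⇒≢ a∈ q∉ ∷ ∈∉⇒≢ a∈ w∉ ∷ [])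
                 ∷ (b≢c ∷ ∈∉⇒≢ b∈ p∉ ∷ ∈∉⇒≢ b∈ q∉ ∷ ∈∉⇒≢ b∈ w∉ ∷ [])
                 ∷ (∈∉⇒≢ c∈ p∉ ∷ ∈∉⇒≢ c∈ q∉ ∷ ∈∉⇒≢ c∈ w∉ ∷ [])
                 ∷ (p≢q ∷ p≢w ∷ []) ∷ (q≢w ∷ []) ∷ [] ∷ []
    ; outer    = All.lookup removed 1st ∷ All.lookup removed 2nd ∷ All.lookup removed 3rd
                 ∷ p∉ ∘ inner ∷ q∉ ∘ inner ∷ w∉ ∘ inner ∷ []
    ; size     = trans size ∣e∣≡r
    ; shape    = relocate
        ( here carved
        ∷ there (here (exchange carved ↭.refl (All.lookup removed 1st) (≢⇒∉₂ a≢b a≢c) (rotate p b c)))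
        ∷ there (there (here (exchange carved (↭.swap a b ↭.refl) (All.lookup removed 2nd)
            (≢⇒∉₂ (≢-sym a≢b) b≢c) (rotate q a c))))
        ∷ there (there (there (here (exchange carved (↭.↭-sym (rotate c a b)) (All.lookup removed 3rd)
            (≢⇒∉₂ (≢-sym a≢c) (≢-sym b≢c)) (rotate w a b)))))
        ∷ []) es⊆
    }
    where
    open Carved (carve {xs = a ∷ b ∷ c ∷ []} ((a≢b ∷ a≢c ∷ []) ∷ (b≢c ∷ []) ∷ [] ∷ []) (a∈ ∷ b∈ ∷ c∈ ∷ []))
    rotate : ∀ (x y z : Fin m) → x ∷ y ∷ z ∷ [] ↭ y ∷ z ∷ x ∷ []
    rotate x y z = ↭.trans (↭.swap x y ↭.refl) (↭.prep y swap₂)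

  -- A path of exchanges collapses to a star in two cases: if c = p, the last edge is e with a
  -- exchanged for w; if a = b, the edge with p becomes a centre. Otherwise c = b gives the graph
  -- path q a b p w, and c ≠ b the tight path q a c b p w.
  path-shape : ∀ {e a p b q c w} → ∣ e ∣ ≡ r → a ∈ₛ e → b ∈ₛ e → c ∈ₛ e ⊖ a ⊕ p →
    p ∉ₛ e → q ∉ₛ e → w ∉ₛ e → p ≢ q → p ≢ w → q ≢ w →
    All (_∈ e ∷ e ⊖ a ⊕ p ∷ e ⊖ b ⊕ q ∷ e ⊖ a ⊕ p ⊖ c ⊕ w ∷ []) es → Shape r es 4
  path-shape {e} {a} {p} {b} {q} {c} {w} ∣e∣≡r a∈ b∈ c∈ p∉ q∉ w∉ p≢q p≢w q≢w es⊆
    with ∈-⊕⁻ c∈ | a Fin.≟ b | b Fin.≟ c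
  ... | inj₁ refl | _ | _ = star₃-shape ∣e∣≡r a∈ b∈ a∈ p∉ q∉ w∉ p≢q p≢w q≢w
    (relocate
      (1st ∷ 2nd ∷ 3rd ∷ there (there (there (here (replace [] (p∉ ∘ proj₂ ∘ ∈-⊖⁻) λ ())))) ∷ []) es⊆)
  -- Both `e` and `e ⊖ a ⊕ q` arise from `e ⊖ a ⊕ p` by exchanging p, and the last edge by
  -- exchanging c.
  ... | inj₂ _ | yes refl | _ = star₃-shape
    (trans (∣S⊕x∣ (p∉ ∘ proj₂ ∘ ∈-⊖⁻)) (trans (∣S⊖x∣ a∈) ∣e∣≡r))
    (x∈S⊕x (e ⊖ a) p) (x∈S⊕x (e ⊖ a) p) c∈
    (∉-⊕⁺ (∈∉⇒≢ a∈ p∉) (x∉S⊖x e a))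
    (∉-⊕⁺ (≢-sym p≢q) (q∉ ∘ proj₂ ∘ ∈-⊖⁻))
    (∉-⊕⁺ (≢-sym p≢w) (w∉ ∘ proj₂ ∘ ∈-⊖⁻))
    (∈∉⇒≢ a∈ q∉) (∈∉⇒≢ a∈ w∉) q≢w
    (relocate
      ( there (here (sym (trans (replace [] (p∉ ∘ proj₂ ∘ ∈-⊖⁻) λ ()) (S⊖x⊕x a∈))))
      ∷ 1st
      ∷ there (there (here (sym (replace [] (p∉ ∘ proj₂ ∘ ∈-⊖⁻) λ ()))))
      ∷ 4th ∷ []) es⊆)
  ... | inj₂ c∈e⊖a | no a≢b | yes refl = path₄ {p = q} {a} {b} {p} {w} record
    { apex     = core
    ; distinct = (≢-sym (∈∉⇒≢ a∈ q∉) ∷ ≢-sym (∈∉⇒≢ b∈ q∉) ∷ ≢-sym p≢q ∷ q≢w ∷ [])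
                 ∷ (a≢b ∷ ∈∉⇒≢ a∈ p∉ ∷ ∈∉⇒≢ a∈ w∉ ∷ []) ∷ (∈∉⇒≢ b∈ p∉ ∷ ∈∉⇒≢ b∈ w∉ ∷ [])
                 ∷ (p≢w ∷ []) ∷ [] ∷ []
    ; outer    = q∉ ∘ inner ∷ All.lookup removed 1st ∷ All.lookup removed 2nd ∷ p∉ ∘ inner ∷ w∉ ∘ inner ∷ []
    ; size     = trans size ∣e∣≡r
    ; shape    = relocate
        ( there (here carved)
        ∷ there (there (here e′≡))
        ∷ here (exchange carved swap₂ (All.lookup removed 2nd) (≢⇒∉₁ (≢-sym a≢b)) ↭.refl)
        ∷ there (there (there (here (exchange e′≡ ↭.refl (All.lookup removed 2nd)
            (≢⇒∉₁ (∈∉⇒≢ b∈ p∉)) swap₂))))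
        ∷ []) es⊆
    }
    where
    open Carved (carve {xs = a ∷ b ∷ []} ((a≢b ∷ []) ∷ [] ∷ []) (a∈ ∷ b∈ ∷ []))
    e′≡ : e ⊖ a ⊕ p ≡ core ⊕* (b ∷ p ∷ [])
    e′≡ = exchange carved ↭.refl (All.lookup removed 1st) (≢⇒∉₁ a≢b) swap₂
  ... | inj₂ c∈e⊖a | no a≢b | no b≢c = tightPath {p = q} {a} {c} {b} {p} {w} record
    { apex     = core
    ; distinct = (≢-sym (∈∉⇒≢ a∈ q∉) ∷ ≢-sym (∈∉⇒≢ c∈e q∉) ∷ ≢-sym (∈∉⇒≢ b∈ q∉) ∷ ≢-sym p≢q ∷ q≢w ∷ [])
                 ∷ (≢-sym c≢a ∷ a≢b ∷ ∈∉⇒≢ a∈ p∉ ∷ ∈∉⇒≢ a∈ w∉ ∷ [])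
                 ∷ (≢-sym b≢c ∷ ∈∉⇒≢ c∈e p∉ ∷ ∈∉⇒≢ c∈e w∉ ∷ [])
                 ∷ (∈∉⇒≢ b∈ p∉ ∷ ∈∉⇒≢ b∈ w∉ ∷ [])
                 ∷ (p≢w ∷ []) ∷ [] ∷ []
    ; outer    = q∉ ∘ inner ∷ All.lookup removed 1st ∷ All.lookup removed 2nd ∷ All.lookup removed 3rd
                 ∷ p∉ ∘ inner ∷ w∉ ∘ inner ∷ []
    ; size     = trans size ∣e∣≡r
    ; shape    = relocate
        ( there (here carved)
        ∷ there (there (here e′≡))
        ∷ here (exchange carved (↭.trans (↭.prep a swap₂) (↭.swap a b ↭.refl)) (All.lookup removed 3rd)
            (≢⇒∉₂ (≢-sym a≢b) b≢c) ↭.refl)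
        ∷ there (there (there (here (exchange e′≡ ↭.refl (All.lookup removed 2nd)
            (≢⇒∉₂ (≢-sym b≢c) (∈∉⇒≢ c∈e p∉)) (↭.trans (↭.swap w b ↭.refl) (↭.prep b swap₂))))))
        ∷ []) es⊆
    }
    where
    c≢a : c ≢ a
    c≢a = proj₁ (∈-⊖⁻ c∈e⊖a)
    c∈e : c ∈ₛ e
    c∈e = proj₂ (∈-⊖⁻ c∈e⊖a)
    open Carved (carve {xs = a ∷ c ∷ b ∷ []} ((≢-sym c≢a ∷ a≢b ∷ []) ∷ (≢-sym b≢c ∷ []) ∷ [] ∷ [])
      (a∈ ∷ c∈e ∷ b∈ ∷ []))
    e′≡ : e ⊖ a ⊕ p ≡ core ⊕* (c ∷ b ∷ p ∷ [])
    e′≡ = exchange carved ↭.refl (All.lookup removed 1st) (≢⇒∉₂ (≢-sym c≢a) a≢b)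
      (↭.trans (↭.swap p c ↭.refl) (↭.prep c swap₂))

⊈⇒∃ : ∀ {S S′ : Subset n} → ¬ S ⊆ₛ S′ → ∃[ x ] x ∈ₛ S × x ∉ₛ S′
⊈⇒∃ {S = S} {S′} S⊈S′ with Fin.any? (λ x → (x ∈ₛ? S) ×-dec (x ∉ₛ? S′))
... | yes found = found
... | no ¬found = contradiction
  (λ {x} x∈ → decidable-stable (x ∈ₛ? S′) (λ x∉ → ¬found (x , x∈ , x∉))) S⊈S′

⊆-size⇒≡ : ∀ {S S′ : Subset n} → S ⊆ₛ S′ → ∣ S ∣ ≡ ∣ S′ ∣ → S ≡ S′
⊆-size⇒≡ {S = S} {S′} S⊆S′ ∣S∣≡∣S′∣ with Fin.any? (λ x → (x ∈ₛ? S′) ×-dec (x ∉ₛ? S))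
... | yes found = contradiction (p⊂q⇒∣p∣<∣q∣ (S⊆S′ , found)) (<-irrefl ∣S∣≡∣S′∣)
... | no ¬found = ⊆-antisym S⊆S′ (λ {x} x∈ → decidable-stable (x ∈ₛ? S) (λ x∉ → ¬found (x , x∈ , x∉)))

-- By size some a in e is missing from e′ without v. The latter lies in e without a, and equal sizes
-- force equality.
exchanged : ∀ {e e′ : Subset n} {v} → ∣ e ∣ ≡ ∣ e′ ∣ → v ∈ₛ e′ → v ∉ₛ e → (e′ - v) ⊆ₛ e →
            ∃[ a ] a ∈ₛ e × e′ ≡ e ⊖ a ⊕ v
exchanged {e = e} {e′} {v} ∣e∣≡ v∈e′ v∉e e′-v⊆e =
  let a , a∈e , a∉ = ⊈⇒∃ e⊈ in
  a , a∈e , trans (sym (S⊖x⊕x v∈e′)) (cong (_⊕ v) (⊆-size⇒≡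
    (λ y∈ → ∈-⊖⁺ (∈∉⇒≢ y∈ a∉) (e′⊖v⊆e y∈))
    (suc-injective (trans (∣S⊖x∣ v∈e′) (trans (sym ∣e∣≡) (sym (∣S⊖x∣ a∈e)))))))
  where
  e′⊖v⊆e : e′ ⊖ v ⊆ₛ e
  e′⊖v⊆e y∈ = let y≢v , y∈e′ = ∈-⊖⁻ y∈ in e′-v⊆e (x∈p∧x≢y⇒x∈p-y y∈e′ y≢v)
  e⊈ : ¬ e ⊆ₛ e′ ⊖ v
  e⊈ e⊆ = <⇒≱ (≤-reflexive (trans (∣S⊖x∣ v∈e′) (sym ∣e∣≡))) (p⊆q⇒∣p∣≤∣q∣ e⊆)

-- From tight orderings to exchanges

record Attached (previous : List (Subset m)) (e′ : Subset m) : Set where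
  field
    {base}   : Subset m
    base∈    : base ∈ previous
    {old}    : Fin m
    {new}    : Fin m
    old∈     : old ∈ₛ base
    new∉     : All (new ∉ₛ_) previous
    e′≡      : e′ ≡ base ⊖ old ⊕ new

lookup-∈-take : (xs : List A) (s : Fin (length xs)) {k : ℕ} → toℕ s < k → lookup xs s ∈ take k xs
lookup-∈-take (x ∷ xs) zero    (s≤s _)   = here refl
lookup-∈-take (x ∷ xs) (suc s) (s≤s s<k) = there (lookup-∈-take xs s s<k)

take-All : {P : A → Set} (xs : List A) (k : ℕ) → (∀ j → toℕ j < k → P (lookup xs j)) → All P (take k xs)
take-All xs       zero    Pxs = []
take-All []       (suc k) Pxs = []
take-All (x ∷ xs) (suc k) Pxs = Pxs zero (s≤s z≤n) ∷ take-All xs k (λ j j<k → Pxs (suc j) (s≤s j<k))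

attached : ∀ {os : List (Subset m)} → All (λ e → ∣ e ∣ ≡ r) os → TightOrder os →
           (i : Fin (length os)) → 1 ≤ toℕ i → Attached (take (toℕ i) os) (lookup os i)
attached {os = os} sizes tight i 1≤i =
  let v , s , v∈ , fresh , s<i , e-v⊆ = tight i 1≤i
      a , a∈ , e≡ = exchanged (trans (size s) (sym (size i))) v∈ (fresh s s<i) e-v⊆
  in record
    { base∈ = lookup-∈-take os s s<i ; old∈ = a∈ ; new∉ = take-All os (toℕ i) fresh ; e′≡ = e≡ }
  where
  size : ∀ j → ∣ lookup os j ∣ ≡ _
  size j = All.lookup sizes (∈-lookup j)

-- Both inclusions are kept: `es⊆` locates the base of a fourth edge, `⊆es` shows that its new
-- vertex avoids the centre and both other edges.
record Star₂ (es : List (Subset m)) : Set where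
  field
    {e}       : Subset m
    {a p b q} : Fin m
    a∈        : a ∈ₛ e
    b∈        : b ∈ₛ e
    p∉        : p ∉ₛ e
    q∉        : q ∉ₛ e
    p≢q       : p ≢ q
    es⊆       : All (_∈ e ∷ e ⊖ a ⊕ p ∷ e ⊖ b ⊕ q ∷ []) es
    ⊆es       : All (_∈ es) (e ∷ e ⊖ a ⊕ p ∷ e ⊖ b ⊕ q ∷ [])

-- If the third edge is attached to the second, the second becomes the centre, since e₁ is recovered
-- from it by exchanging p back for a.
star₂ : ∀ {e₁ e₂ e₃ : Subset m} → Attached (e₁ ∷ []) e₂ → Attached (e₁ ∷ e₂ ∷ []) e₃ →
        Star₂ (e₁ ∷ e₂ ∷ e₃ ∷ [])
star₂ {e₁ = e} record { base∈ = 1st ; old = a ; new = p ; old∈ = a∈ ; new∉ = p∉ ∷ [] ; e′≡ = refl }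
      record { base∈ = 1st ; old∈ = b∈ ; new∉ = q∉ ∷ q∉e₂ ∷ [] ; e′≡ = refl } = record
  { a∈ = a∈ ; b∈ = b∈ ; p∉ = p∉ ; q∉ = q∉ ; p≢q = ∈∉⇒≢ (x∈S⊕x (e ⊖ a) p) q∉e₂
  ; es⊆ = 1st ∷ 2nd ∷ 3rd ∷ [] ; ⊆es = 1st ∷ 2nd ∷ 3rd ∷ [] }
star₂ {e₁ = e} record { base∈ = 1st ; old = a ; new = p ; old∈ = a∈ ; new∉ = p∉ ∷ [] ; e′≡ = refl }
      record { base∈ = 2nd ; old∈ = b∈ ; new∉ = q∉ ∷ q∉e₂ ∷ [] ; e′≡ = refl } = record
  { a∈ = x∈S⊕x (e ⊖ a) p ; b∈ = b∈ ; p∉ = ∉-⊕⁺ (∈∉⇒≢ a∈ p∉) (x∉S⊖x e a) ; q∉ = q∉e₂ ; p≢q = ∈∉⇒≢ a∈ q∉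
  ; es⊆ = there (here (sym e₁≡)) ∷ 1st ∷ 3rd ∷ [] ; ⊆es = 2nd ∷ here e₁≡ ∷ 3rd ∷ [] }
  where
  e₁≡ : e ⊖ a ⊕ p ⊖ p ⊕ a ≡ e
  e₁≡ = trans (replace [] (p∉ ∘ proj₂ ∘ ∈-⊖⁻) λ ()) (S⊖x⊕x a∈)

shape₃ : ∀ {es : List (Subset m)} → All (λ e → ∣ e ∣ ≡ r) es → Star₂ es → Shape r es 3
shape₃ sizes s = star₂-shape (All.lookup sizes (All.head ⊆es)) a∈ b∈ p∉ q∉ p≢q es⊆
  where open Star₂ s

shape₄ : ∀ {es : List (Subset m)} {e₄} → All (λ e → ∣ e ∣ ≡ r) es → Star₂ es → Attached es e₄ →
         Shape r (es ++ e₄ ∷ []) 4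
shape₄ {r = r} {es} sizes s record { base∈ = f∈ ; old = c ; new = w ; old∈ = c∈ ; new∉ = w∉ ; e′≡ = refl }
  with All.lookup es⊆ f∈ | All.lookup w∉ (All.head ⊆es)
     | All.lookup w∉ (All.lookup ⊆es 2nd) | All.lookup w∉ (All.lookup ⊆es 3rd)
  where open Star₂ s
... | f∈′ | w∉e | w∉e′ | w∉e″ = by-base f∈′ c∈
  where
  open Star₂ s
  ∣e∣≡r : ∣ e ∣ ≡ r
  ∣e∣≡r = All.lookup sizes (All.head ⊆es)
  p≢w : p ≢ w
  p≢w = ∈∉⇒≢ (x∈S⊕x (e ⊖ a) p) w∉e′
  q≢w : q ≢ w
  q≢w = ∈∉⇒≢ (x∈S⊕x (e ⊖ b) q) w∉e″
  all⊆ : ∀ {e₄} → All (_∈ e ∷ e ⊖ a ⊕ p ∷ e ⊖ b ⊕ q ∷ e₄ ∷ []) (es ++ e₄ ∷ [])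
  all⊆ = All-++⁺ (All.map ∈-++⁺ˡ es⊆) (4th ∷ [])
  -- Attaching to the centre gives a star of exchanges, attaching to either of the other two edges a
  -- path; the last case interchanges (a, p) with (b, q).
  by-base : ∀ {f} → f ∈ e ∷ e ⊖ a ⊕ p ∷ e ⊖ b ⊕ q ∷ [] → c ∈ₛ f → Shape r (es ++ f ⊖ c ⊕ w ∷ []) 4
  by-base 1st c∈ = star₃-shape ∣e∣≡r a∈ b∈ c∈ p∉ q∉ w∉e p≢q p≢w q≢w all⊆
  by-base 2nd c∈ = path-shape ∣e∣≡r a∈ b∈ c∈ p∉ q∉ w∉e p≢q p≢w q≢w all⊆
  by-base 3rd c∈ = path-shape ∣e∣≡r b∈ a∈ c∈ q∉ p∉ w∉e (≢-sym p≢q) q≢w p≢w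
    (relocate (1st ∷ 3rd ∷ 2nd ∷ 4th ∷ []) all⊆)

classify : ∀ (os : List (Subset m)) → 0 < r → All (λ e → ∣ e ∣ ≡ r) os → TightOrder os →
           1 ≤ length os → length os ≤ 4 → Shape r os (length os)
classify (e ∷ []) 0<r (∣e∣≡r ∷ []) tight _ _ =
  let a , a∈ = nonempty {S = e} (subst (0 <_) (sym ∣e∣≡r) 0<r)
  in singles {x = a} {[]} record
    { apex = e ⊖ a ; distinct = [] ∷ [] ; outer = x∉S⊖x e a ∷ [] ; size = trans (∣S⊖x∣ a∈) ∣e∣≡r
    ; shape = here (sym (S⊖x⊕x a∈)) ∷ [] }
classify (e ∷ e′ ∷ []) 0<r sizes tight _ _ with attached sizes tight (suc zero) ≤-refl
... | record { base∈ = 1st ; old = a ; new = p ; old∈ = a∈ ; new∉ = p∉ ∷ [] ; e′≡ = refl } =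
  singles {x = a} {p ∷ []} record
    { apex = e ⊖ a ; distinct = (∈∉⇒≢ a∈ p∉ ∷ []) ∷ [] ∷ []
    ; outer = x∉S⊖x e a ∷ p∉ ∘ proj₂ ∘ ∈-⊖⁻ ∷ [] ; size = trans (∣S⊖x∣ a∈) (All.head sizes)
    ; shape = here (sym (S⊖x⊕x a∈)) ∷ 2nd ∷ [] }
classify (e₁ ∷ e₂ ∷ e₃ ∷ []) 0<r sizes tight _ _ = shape₃ sizes
  (star₂ (attached sizes tight (suc zero) ≤-refl) (attached sizes tight (suc (suc zero)) (s≤s z≤n)))
classify (e₁ ∷ e₂ ∷ e₃ ∷ e₄ ∷ []) 0<r sizes@(s₁ ∷ s₂ ∷ s₃ ∷ _) tight _ _ = shape₄ (s₁ ∷ s₂ ∷ s₃ ∷ [])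
  (star₂ (attached sizes tight (suc zero) ≤-refl) (attached sizes tight (suc (suc zero)) (s≤s z≤n)))
  (attached sizes tight (suc (suc (suc zero))) (s≤s z≤n))
classify (_ ∷ _ ∷ _ ∷ _ ∷ _ ∷ _) _ _ _ _ (s≤s (s≤s (s≤s (s≤s ()))))

shape-↭ : ∀ {es os : List (Subset m)} {t} → os ↭ es → Shape r os t → Shape r es t
shape-↭ {r = r} os↭es = λ
  { (singles c)   → singles (cone-↭ c)
  ; (path₃ c)     → path₃ (cone-↭ c)
  ; (fork c)      → fork (cone-↭ c)
  ; (path₄ c)     → path₄ (cone-↭ c)
  ; (star c)      → star (cone-↭ c)
  ; (tightPath c) → tightPath (cone-↭ c)
  }
  where
  cone-↭ : ∀ {j labels ls} → Cone r _ j labels ls → Cone r _ j labels ls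
  cone-↭ c = record { Cone c ; shape = All-resp-↭ os↭es (Cone.shape c) }

-- `ℚ./` reduces to lowest terms, so the cross-multiplication is done with unnormalised rationals.
≤⇒≤ℚ : ∀ r .{{_ : NonZero r}} e k s → r * e ≤ k * s →
       (ℤ.+ e) ℚ./ 1 ℚ.≤ ((ℤ.+ k) ℚ./ r) ℚ.* ((ℤ.+ s) ℚ./ 1)
≤⇒≤ℚ r@(suc r-1) e k s re≤ks = ℚ.toℚᵘ-cancel-≤ (begin
  ℚ.toℚᵘ ((ℤ.+ e) ℚ./ 1)                                      ≃⟨ ℚ.toℚᵘ-fromℚᵘ (ℚᵘ.mkℚᵘ (ℤ.+ e) 0) ⟩
  ℚᵘ.mkℚᵘ (ℤ.+ e) 0                                           ≤⟨ ℚᵘ.*≤* goal ⟩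
  ℚᵘ.mkℚᵘ (ℤ.+ k) r-1 ℚᵘ.* ℚᵘ.mkℚᵘ (ℤ.+ s) 0
    ≃⟨ ℚᵘ.*-cong (ℚ.toℚᵘ-fromℚᵘ (ℚᵘ.mkℚᵘ (ℤ.+ k) r-1)) (ℚ.toℚᵘ-fromℚᵘ (ℚᵘ.mkℚᵘ (ℤ.+ s) 0)) ⟨
  ℚ.toℚᵘ ((ℤ.+ k) ℚ./ r) ℚᵘ.* ℚ.toℚᵘ ((ℤ.+ s) ℚ./ 1)
    ≃⟨ ℚ.toℚᵘ-homo-* ((ℤ.+ k) ℚ./ r) ((ℤ.+ s) ℚ./ 1) ⟨
  ℚ.toℚᵘ (((ℤ.+ k) ℚ./ r) ℚ.* ((ℤ.+ s) ℚ./ 1))                  ∎)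
  where
  open ℚᵘ.≤-Reasoning
  -- `suc (r-1 * 1)` is the denominator r · 1 of the product as it unfolds.
  goal : ℤ.+ e ℤ.* ℤ.+ suc (r-1 * 1) ℤ.≤ ℤ.+ k ℤ.* ℤ.+ s ℤ.* ℤ.+ 1
  goal = subst₂ ℤ._≤_
    (trans (cong ℤ.+_ (trans (*-comm r e) (cong (λ d → e * suc d) (sym (*-identityʳ r-1)))))
      (ℤ.pos-* e (suc (r-1 * 1))))
    (trans (ℤ.pos-* k s) (sym (ℤ.*-identityʳ (ℤ.+ k ℤ.* ℤ.+ s))))
    (ℤ.+≤+ re≤ks)

theorem1 : (r : ℕ) .{{_ : NonZero r}} → 2 ≤ r →
    (m : ℕ) (T : RGraph m r) → IsTightTree T → e[ T ] ≤ 4 →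
    (n : ℕ) (G : RGraph n r) → ¬ Contains G T →
    (ℤ.+ e[ G ]) ℚ./ 1 ℚ.≤ ((ℤ.+ (e[ T ] ∸ 1)) ℚ./ r) ℚ.* ((ℤ.+ length (∂ G)) ℚ./ 1)
theorem1 r 2≤r m T tree e≤4 n G ¬contains =
  ≤⇒≤ℚ r e[ G ] (e[ T ] ∸ 1) (length (∂ G)) (edges≤ G 2≤r (e[ T ] ∸ 1) (shape-bound G T covered ¬contains
    (subst (Shape r (edges T)) (↭-length permutes) (shape-↭ permutes (classify ordering
      (<⇒≤ 2≤r) (All-resp-↭ (↭.↭-sym permutes) (uniform T)) tight
      (subst (1 ≤_) (sym (↭-length permutes)) nonEmpty)
      (subst (_≤ 4) (sym (↭-length permutes)) e≤4))))))
  where open IsTightTree tree
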